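{- Let $k\ge 1$ be an integer and let $r_0,\dots,r_k$ be distinct integers. Then there is an integer $M\ge 1$ such that, for each $\xi\in\mathbb{R}$, there exists at least one index $i\in\{0,1,\dots,k\}$ with $r_i\neq\xi$ for which the point $\xi_i=1/(M(\xi-r_i))$ satisfies \[ \omega^{\mathrm{lead}}_k(\xi_i)=\omega_k(\xi_i)=\omega_k(\xi). \]
   Context: For a polynomial $P\in\mathbb{Z}[x]$, $\|P\|$ denotes the largest absolute value of its coefficients, and $c_k(P)$ denotes the coefficient of $x^k$ in $P$. For $\xi\in\mathbb{R}$ and an integer $n\ge 1$, $\omega_n(\xi)$ is the supremum of all $\omega\in\mathbb{R}$ for which there exist infinitely many non-zero polynomials $P\in\mathbb{Z}[x]$ of degree at most $n$ with $|P(\xi)|\le\|P\|^{ -\omega}$. The quantity $\omega^{\mathrm{lead}}_k(\xi)$ is defined in the same way as $\omega_k(\xi)$, except that one restricts to non-zero polynomials $P\in\mathbb{Z}[x]$ of degree at most $k$ satisfying $|c_k(P)|=\|P\|$. -}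

module Defs where

open import Level using (0ℓ; suc)
open import Axiom.ExcludedMiddle using (ExcludedMiddle)
open import Algebra.Bundles using (CommutativeRing; Semiring)
open import Relation.Binary.Bundles using (TotalOrder)
open import Relation.Binary.Core using (Rel)
open import Relation.Binary.Structures using (IsTotalOrder)
open import Relation.Binary.PropositionalEquality using (_≡_; _≢_)
open import Relation.Nullary using (¬_; yes; no)
open import Relation.Nullary.Construct.Add.Extrema using (_±; ⊥±; ⊤±; [_])
open import Relation.Unary using (Pred; Satisfiable)
open import Data.Nat.Base as ℕ using (ℕ)
open import Data.Integer.Base as ℤ using (ℤ; +_; -[1+_])
open import Data.Rational.Base as ℚ using (ℚ)
open import Data.Fin.Base using (fromℕ)
open import Data.List.Base using (List)
open import Data.List.Membership.Propositional using (_∈_)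
open import Data.Product.Base using (Σ; ∃-syntax; _×_; proj₁)
open import Data.Vec.Base using (Vec; []; _∷_; lookup; replicate; foldr′)
import Algebra.Construct.NaturalChoice.Max as Max
import Algebra.Definitions.RawSemiring as RawSemiringDefs
import Relation.Binary.Construct.Add.Extrema.Equality as ExtremaEquality

-- The axioms of ℝ: classically, a model exists and is unique up to
-- isomorphism.  Equality is the setoid equality of the underlying ring.
-- The value of 0# ⁻¹ is left unspecified.
record CompleteOrderedField : Set (suc 0ℓ) where
  infix 8 _⁻¹
  infix 4 _≤_
  field
    commutativeRing : CommutativeRing 0ℓ 0ℓ
  open CommutativeRing commutativeRing public
  field
    0≉1          : ¬ (0# ≈ 1#)
    _⁻¹          : Carrier → Carrier
    ⁻¹-cong      : ∀ {x y} → x ≈ y → x ⁻¹ ≈ y ⁻¹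
    ⁻¹-inverseʳ  : ∀ {x} → ¬ (x ≈ 0#) → x * x ⁻¹ ≈ 1#
    _≤_          : Rel Carrier 0ℓ
    isTotalOrder : IsTotalOrder _≈_ _≤_
    +-monoˡ-≤    : ∀ {x y} z → x ≤ y → x + z ≤ y + z
    *-nonNeg     : ∀ {x y} → 0# ≤ x → 0# ≤ y → 0# ≤ x * y

  UpperBound : Pred Carrier 0ℓ → Pred Carrier 0ℓ
  UpperBound S b = ∀ {x} → S x → x ≤ b

  IsLUB : Pred Carrier 0ℓ → Pred Carrier 0ℓ
  IsLUB S s = UpperBound S s × (∀ {b} → UpperBound S b → s ≤ b)

  field
    complete : (S : Pred Carrier 0ℓ) → Satisfiable S →
               Satisfiable (UpperBound S) → Σ Carrier (IsLUB S)

Finite : {A : Set} → Pred A 0ℓ → Set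
Finite {A} S = ∃[ xs ] (∀ {x : A} → S x → x ∈ xs)

Infinite : {A : Set} → Pred A 0ℓ → Set
Infinite S = ¬ Finite S

-- Polynomials in ℤ[x] of degree at most n, as the vector of the coefficients
-- of x⁰, x¹, …, xⁿ.
Poly : ℕ → Set
Poly n = Vec ℤ (ℕ.suc n)

0ᵖ : ∀ {n} → Poly n
0ᵖ = replicate _ ℤ.0ℤ

‖_‖ : ∀ {m} → Vec ℤ m → ℕ
‖_‖ = foldr′ (λ c h → ℤ.∣ c ∣ ℕ.⊔ h) 0

leadCoeff : ∀ n → Poly n → ℤ
leadCoeff n P = lookup P (fromℕ n)

-- Excluded middle is used to form suprema in the extended reals.
module Exponents (lem : ExcludedMiddle 0ℓ) (ℝ : CompleteOrderedField) where

  open CompleteOrderedField ℝ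

  totalOrder : TotalOrder 0ℓ 0ℓ 0ℓ
  totalOrder = record { isTotalOrder = isTotalOrder }

  open Max totalOrder using (_⊔_)
  open RawSemiringDefs (Semiring.rawSemiring semiring) using (_^_) renaming (_×_ to _×ⁿ_)
  open ExtremaEquality _≈_ public using (_≈±_)

  ∣_∣ : Carrier → Carrier
  ∣ x ∣ = x ⊔ (- x)

  fromℕᴿ : ℕ → Carrier
  fromℕᴿ n = n ×ⁿ 1#

  fromℤ : ℤ → Carrier
  fromℤ (+ n)    = fromℕᴿ n
  fromℤ -[1+ n ] = - fromℕᴿ (ℕ.suc n)

  fromℚ : ℚ → Carrier
  fromℚ q = fromℤ (ℚ.numerator q) * fromℤ (ℚ.denominator q) ⁻¹

  sup : Pred Carrier 0ℓ → Carrier ±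
  sup S with lem {Satisfiable S} | lem {Satisfiable (UpperBound S)}
  ... | no  _        | _           = ⊥±
  ... | yes _        | no  _       = ⊤±
  ... | yes nonempty | yes bounded = [ proj₁ (complete S nonempty bounded) ]

  -- Only used at finite values; the values at ±∞ are arbitrary.
  real : Carrier ± → Carrier
  real [ x ] = x
  real ⊥±    = 0#
  real ⊤±    = 0#

  _^ℤ_ : Carrier → ℤ → Carrier
  b ^ℤ (+ n)    = b ^ n
  b ^ℤ -[1+ n ] = (b ⁻¹) ^ ℕ.suc n

  -- For b ≥ 1 and real x, bˣ is the supremum of the powers bᵖᐟᵠ over the
  -- rationals p/q ≤ x, and bᵖᐟᵠ is in turn the largest y ≥ 0 with y^q ≤ b^p.
  -- The set below is then nonempty and bounded.  The definition is not
  -- meaningful for b < 1; it is applied only to the norm of a non-zero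
  -- integer polynomial.
  _^ᴿ_ : Carrier → Carrier → Carrier
  b ^ᴿ x = real (sup λ y → 0# ≤ y × (∃[ q ] (fromℚ q ≤ x
                  × y ^ ℚ.denominatorℕ q ≤ b ^ℤ ℚ.numerator q)))

  eval : ∀ {m} → Vec ℤ m → Carrier → Carrier
  eval []       x = 0#
  eval (c ∷ cs) x = fromℤ c + x * eval cs x

  Approx : ∀ n → Carrier → Carrier → Pred (Poly n) 0ℓ
  Approx n ξ w P = P ≢ 0ᵖ × ∣ eval P ξ ∣ ≤ fromℕᴿ ‖ P ‖ ^ᴿ (- w)

  ω : ℕ → Carrier → Carrier ±
  ω n ξ = sup λ w → Infinite (Approx n ξ w)

  ωˡᵉᵃᵈ : ℕ → Carrier → Carrier ±
  ωˡᵉᵃᵈ k ξ = sup λ w → Infinite λ P →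
    Approx k ξ w P × ℤ.∣ leadCoeff k P ∣ ≡ ‖ P ‖

{-# OPTIONS --safe #-}

-- Write P(x + rᵢ) = a₀ + a₁ x + … + a_k x^k.  Substituting x = 1/(M y) and
-- clearing denominators turns P into a polynomial Q with leading coefficient
-- M^k a₀ = M^k P(rᵢ), whose other coefficients are at most M^(k−1) times a
-- multiple of ‖P‖.  By interpolation ‖P‖ ≤ I |P(rᵢ)| for some i, where I depends
-- on the points only; so if M is large, Q attains its norm at the leading
-- coefficient.  The norms of P and Q are comparable, and Q(ξᵢ) is a fixed
-- multiple of P(ξ); the constants do not affect the exponents.  As the sets of
-- approximating polynomials shrink when w grows, one index i serves all w.

module Submission where

open import Defs
open import Level using (0ℓ)
open import Axiom.ExcludedMiddle using (ExcludedMiddle)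
open import Algebra.Bundles using (CommutativeRing)
open import Algebra.Solver.Ring.AlmostCommutativeRing
  using (fromCommutativeRing; _-Raw-AlmostCommutative⟶_)
open import Data.Fin.Base using (Fin; zero; suc; fromℕ)
open import Data.Fin.Properties using (suc-injective)
open import Data.Integer.Base as ℤ using (ℤ; +_; -[1+_])
open import Data.Integer.GCD using (gcd)
open import Data.List.Base using (List; []; _∷_; _++_; map; upTo; allFin; cartesianProductWith)
open import Data.List.Membership.Propositional using (_∈_)
open import Data.List.Membership.Propositional.Properties
  using (∈-cartesianProductWith⁺; ∈-++⁺ˡ; ∈-++⁺ʳ; ∈-map⁺; ∈-upTo⁺; ∈-allFin)
open import Data.List.Relation.Unary.Any using (here; there)
open import Data.Maybe.Base using (Maybe; just; nothing)
open import Data.Nat.Base as ℕ using (ℕ; zero; suc; z≤n; s≤s)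
open import Data.Nat.Solver using (module +-*-Solver)
open import Data.Product.Base using (∃-syntax; _×_; _,_; proj₁; proj₂)
open import Data.Rational.Base as ℚ using (ℚ)
open import Data.Sum.Base using (inj₁; inj₂)
open import Data.Vec.Base using (Vec; []; _∷_; _∷ʳ_; lookup; replicate)
open import Function.Base using (_∘_; case_of_)
open import Function.Definitions using (Injective)
open import Relation.Binary.Bundles using (TotalOrder)
open import Relation.Binary.PropositionalEquality
  using (_≡_; _≢_; refl; sym; trans; cong; cong₂; subst; module ≡-Reasoning)
open import Relation.Nullary using (¬_; yes; no; contradiction)
open import Relation.Unary using (Pred; Satisfiable)
import Algebra.Construct.NaturalChoice.Max
import Algebra.Properties.CommutativeSemiring.Exp
import Algebra.Properties.Ring
import Algebra.Properties.Semiring.Mult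
import Algebra.Solver.Ring
import Data.Integer.Properties as ℤₚ
import Data.Integer.Solver as ℤSolver
import Data.List.Extrema as Extrema
import Data.List.Relation.Unary.All as All
import Data.Nat.Properties as ℕₚ
import Data.Rational.Properties as ℚₚ
import Relation.Binary.Construct.Add.Extrema.Equality as E
import Relation.Binary.Reasoning.PartialOrder

-- A constant factor cannot be absorbed at a fixed exponent, only at a strictly smaller one and for
-- polynomials of large norm. For this reason infinite sets are handled as sets of unbounded norm,
-- and sets of exponents are compared by `_⊑_`, which gives up an arbitrarily small part of w and
-- does not affect suprema. The point ξ may be one of the rⱼ, and the index that serves all w could
-- then be this very j, for which ξⱼ makes no sense. In this case the index is chosen for the
-- non-zero polynomials that vanish at ξ: they approximate ξ to every order, and their values at ξ
-- are useless for bounding their norms. The relation M (ξ - rᵢ) ξᵢ = 1 is symmetric in ξ - rᵢ and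
-- ξᵢ, so the same substitution also leads from approximations of ξᵢ back to ξ. The exponents close
-- up in a cycle: ω(ξ) is at most the leading exponent of ξᵢ, which is at most ω(ξᵢ), which is at
-- most ω(ξ).

fraction : ∀ i d .{{_ : ℕ.NonZero d}} → ∃[ r ] (ℚ.numerator r ℤ.* + d ≡ i ℤ.* ℚ.denominator r)
fraction i d = r , (begin
  n ℤ.* + d        ≡⟨ cong (n ℤ.*_) (sym (ℚₚ.↧-/ i d)) ⟩
  n ℤ.* (e ℤ.* g)  ≡⟨ cong (n ℤ.*_) (ℤₚ.*-comm e g) ⟩
  n ℤ.* (g ℤ.* e)  ≡⟨ sym (ℤₚ.*-assoc n g e) ⟩
  n ℤ.* g ℤ.* e    ≡⟨ cong (ℤ._* e) (ℚₚ.↥-/ i d) ⟩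
  i ℤ.* e          ∎)
  where
  open ≡-Reasoning
  r = i ℚ./ d
  n = ℚ.numerator r
  e = ℚ.denominator r
  g = gcd i (+ d)

-- Integer polynomials as coefficient vectors

private variable
  m n : ℕ

evalℤ : Vec ℤ m → ℤ → ℤ
evalℤ []       x = ℤ.0ℤ
evalℤ (c ∷ cs) x = c ℤ.+ x ℤ.* evalℤ cs x

-- The quotient of P by x − r (Horner's scheme).
quot : ℤ → Vec ℤ (suc m) → Vec ℤ m
quot r (c ∷ [])         = []
quot r (c ∷ cs@(_ ∷ _)) = evalℤ cs r ∷ quot r cs

-- The coefficients of P(x + r) as a polynomial in x.
shift : ℤ → Vec ℤ m → Vec ℤ m
shift {zero}  r []           = []
shift {suc m} r P            = evalℤ P r ∷ shift r (quot r P)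

-- (M x)^(m − 1) P(1/(M x)).
revScale : ℕ → Vec ℤ m → Vec ℤ m
revScale         M []       = []
revScale {suc m} M (c ∷ cs) = revScale M cs ∷ʳ (c ℤ.* + (M ℕ.^ m))

evalℤ-quot : ∀ r x (P : Vec ℤ (suc m)) →
             evalℤ P x ≡ evalℤ P r ℤ.+ (x ℤ.- r) ℤ.* evalℤ (quot r P) x
evalℤ-quot r x (c ∷ []) =
  solve 3 (λ c r x → c :+ x :* con ℤ.0ℤ := c :+ r :* con ℤ.0ℤ :+ (x :- r) :* con ℤ.0ℤ) refl c r x
  where open ℤSolver.+-*-Solver
evalℤ-quot r x (c ∷ cs@(_ ∷ _)) = begin
  c ℤ.+ x ℤ.* evalℤ cs x             ≡⟨ cong (λ e → c ℤ.+ x ℤ.* e) (evalℤ-quot r x cs) ⟩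
  c ℤ.+ x ℤ.* (e ℤ.+ (x ℤ.- r) ℤ.* q) ≡⟨ solve 5 (λ c r x e q →
      c :+ x :* (e :+ (x :- r) :* q) := c :+ r :* e :+ (x :- r) :* (e :+ x :* q)) refl c r x e q ⟩
  c ℤ.+ r ℤ.* e ℤ.+ (x ℤ.- r) ℤ.* (e ℤ.+ x ℤ.* q) ∎
  where
  open ≡-Reasoning
  open ℤSolver.+-*-Solver
  e = evalℤ cs r
  q = evalℤ (quot r cs) x

-- Estimates for the norm


‖‖-∷-lub : ∀ c {D} (cs : Vec ℤ m) → ℤ.∣ c ∣ ℕ.≤ D → ‖ cs ‖ ℕ.≤ D → ‖ c ∷ cs ‖ ℕ.≤ D
‖‖-∷-lub c cs = ℕₚ.⊔-lub

∣head∣≤‖‖ : ∀ c (cs : Vec ℤ m) → ℤ.∣ c ∣ ℕ.≤ ‖ c ∷ cs ‖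
∣head∣≤‖‖ c cs = ℕₚ.m≤m⊔n _ _

‖tail‖≤‖‖ : ∀ c (cs : Vec ℤ m) → ‖ cs ‖ ℕ.≤ ‖ c ∷ cs ‖
‖tail‖≤‖‖ c cs = ℕₚ.m≤n⊔m ℤ.∣ c ∣ _

‖∷ʳ‖ : ∀ (cs : Vec ℤ m) c → ‖ cs ∷ʳ c ‖ ≡ ‖ cs ‖ ℕ.⊔ ℤ.∣ c ∣
‖∷ʳ‖ []       c = ℕₚ.⊔-identityʳ _
‖∷ʳ‖ (d ∷ cs) c = trans (cong (ℤ.∣ d ∣ ℕ.⊔_) (‖∷ʳ‖ cs c)) (sym (ℕₚ.⊔-assoc ℤ.∣ d ∣ ‖ cs ‖ ℤ.∣ c ∣))

lookup-∷ʳ-fromℕ : ∀ (cs : Vec ℤ m) c → lookup (cs ∷ʳ c) (fromℕ m) ≡ c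
lookup-∷ʳ-fromℕ []       c = refl
lookup-∷ʳ-fromℕ (_ ∷ cs) c = lookup-∷ʳ-fromℕ cs c

‖0ᵖ‖ : ∀ m → ‖ replicate m ℤ.0ℤ ‖ ≡ 0
‖0ᵖ‖ zero    = refl
‖0ᵖ‖ (suc m) = ‖0ᵖ‖ m

‖‖≡0⇒≡0ᵖ : (P : Vec ℤ m) → ‖ P ‖ ≡ 0 → P ≡ replicate m ℤ.0ℤ
‖‖≡0⇒≡0ᵖ []       _  = refl
‖‖≡0⇒≡0ᵖ (c ∷ cs) eq = cong₂ _∷_
  (ℤₚ.∣i∣≡0⇒i≡0 (ℕₚ.n≤0⇒n≡0 (subst (ℤ.∣ c ∣ ℕ.≤_) eq (∣head∣≤‖‖ c cs))))
  (‖‖≡0⇒≡0ᵖ cs (ℕₚ.n≤0⇒n≡0 (subst (‖ cs ‖ ℕ.≤_) eq (‖tail‖≤‖‖ c cs))))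

1≤‖‖⇒≢0ᵖ : (P : Poly m) → 1 ℕ.≤ ‖ P ‖ → P ≢ 0ᵖ
1≤‖‖⇒≢0ᵖ {m} P 1≤ refl = contradiction (subst (1 ℕ.≤_) (‖0ᵖ‖ m) 1≤) λ ()

≢0ᵖ⇒1≤‖‖ : (P : Poly m) → P ≢ 0ᵖ → 1 ℕ.≤ ‖ P ‖
≢0ᵖ⇒1≤‖‖ P P≢0 = ℕₚ.n≢0⇒n>0 (P≢0 ∘ ‖‖≡0⇒≡0ᵖ P)

∣c+ry∣≤ : ∀ c r y {D E ρ} → ℤ.∣ r ∣ ℕ.≤ ρ → ℤ.∣ c ∣ ℕ.≤ D → ℤ.∣ y ∣ ℕ.≤ E →
          ℤ.∣ c ℤ.+ r ℤ.* y ∣ ℕ.≤ D ℕ.+ ρ ℕ.* E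
∣c+ry∣≤ c r y {D} {E} {ρ} r≤ c≤ y≤ = begin
  ℤ.∣ c ℤ.+ r ℤ.* y ∣          ≤⟨ ℤₚ.∣i+j∣≤∣i∣+∣j∣ c (r ℤ.* y) ⟩
  ℤ.∣ c ∣ ℕ.+ ℤ.∣ r ℤ.* y ∣     ≡⟨ cong (ℤ.∣ c ∣ ℕ.+_) (ℤₚ.abs-* r y) ⟩
  ℤ.∣ c ∣ ℕ.+ ℤ.∣ r ∣ ℕ.* ℤ.∣ y ∣ ≤⟨ ℕₚ.+-mono-≤ c≤ (ℕₚ.*-mono-≤ r≤ y≤) ⟩
  D ℕ.+ ρ ℕ.* E               ∎
  where open ℕₚ.≤-Reasoning

1≤^ : ∀ a m → 1 ℕ.≤ suc a ℕ.^ m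
1≤^ a m = ℕₚ.m^n>0 (suc a) m

-- A Horner step adds at most ‖P‖ to ρ times the previous bound E ‖P‖; as E ≥ 1, the total is at
-- most (1 + ρ) E ‖P‖.
∣evalℤ∣≤ : ∀ {r ρ} → ℤ.∣ r ∣ ℕ.≤ ρ → (P : Vec ℤ m) → ℤ.∣ evalℤ P r ∣ ℕ.≤ suc ρ ℕ.^ m ℕ.* ‖ P ‖
∣evalℤ∣≤ r≤ [] = z≤n
∣evalℤ∣≤ {suc m} {r} {ρ} r≤ P@(c ∷ cs) = begin
  ℤ.∣ c ℤ.+ r ℤ.* evalℤ cs r ∣ ≤⟨ ∣c+ry∣≤ c r (evalℤ cs r) r≤ (∣head∣≤‖‖ c cs)
      (ℕₚ.≤-trans (∣evalℤ∣≤ r≤ cs) (ℕₚ.*-monoʳ-≤ E (‖tail‖≤‖‖ c cs))) ⟩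
  ‖ P ‖ ℕ.+ ρ ℕ.* (E ℕ.* ‖ P ‖) ≤⟨ ℕₚ.+-monoˡ-≤ _ (ℕₚ.m≤n*m ‖ P ‖ E {{ℕ.>-nonZero (1≤^ ρ m)}}) ⟩
  E ℕ.* ‖ P ‖ ℕ.+ ρ ℕ.* (E ℕ.* ‖ P ‖) ≡⟨ sym (ℕₚ.*-assoc (suc ρ) E ‖ P ‖) ⟩
  suc ρ ℕ.* E ℕ.* ‖ P ‖ ∎
  where
  open ℕₚ.≤-Reasoning
  E = suc ρ ℕ.^ m

-- The coefficients of the quotient are the values at r of the tails of P.
‖quot‖≤ : ∀ {r ρ} → ℤ.∣ r ∣ ℕ.≤ ρ → (P : Vec ℤ (suc m)) → ‖ quot r P ‖ ℕ.≤ suc ρ ℕ.^ m ℕ.* ‖ P ‖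
‖quot‖≤ r≤ (c ∷ []) = z≤n
‖quot‖≤ {suc m} {r} {ρ} r≤ (c ∷ cs@(_ ∷ _)) = ‖‖-∷-lub (evalℤ cs r) (quot r cs)
  (ℕₚ.≤-trans (∣evalℤ∣≤ {r = r} r≤ cs) (ℕₚ.*-monoʳ-≤ (suc ρ ℕ.^ suc m) (‖tail‖≤‖‖ c cs)))
  (ℕₚ.≤-trans (‖quot‖≤ r≤ cs)
    (ℕₚ.*-mono-≤ (ℕₚ.m≤n*m (suc ρ ℕ.^ m) (suc ρ)) (‖tail‖≤‖‖ c cs)))

-- The product of (1 + ρ)^j for j = 1, ..., m: the successive quotients have lengths m, m - 1, ...,
-- and a division at length j costs at most (1 + ρ)^j.
shiftBound : ℕ → ℕ → ℕ
shiftBound ρ zero    = 1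
shiftBound ρ (suc m) = shiftBound ρ m ℕ.* suc ρ ℕ.^ suc m

1≤shiftBound : ∀ ρ m → 1 ℕ.≤ shiftBound ρ m
1≤shiftBound ρ zero    = s≤s z≤n
1≤shiftBound ρ (suc m) = ℕₚ.*-mono-≤ (1≤shiftBound ρ m) (1≤^ ρ (suc m))

‖shift‖≤ : ∀ {r ρ} → ℤ.∣ r ∣ ℕ.≤ ρ → (P : Vec ℤ m) → ‖ shift r P ‖ ℕ.≤ shiftBound ρ m ℕ.* ‖ P ‖
‖shift‖≤ {zero} r≤ [] = z≤n
‖shift‖≤ {suc m} {r} {ρ} r≤ P = ‖‖-∷-lub (evalℤ P r) (shift r (quot r P))
  (begin
    ℤ.∣ evalℤ P r ∣       ≤⟨ ∣evalℤ∣≤ {r = r} r≤ P ⟩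
    E ℕ.* ‖ P ‖          ≤⟨ ℕₚ.*-monoˡ-≤ ‖ P ‖ (ℕₚ.m≤n*m E S {{ℕ.>-nonZero (1≤shiftBound ρ m)}}) ⟩
    S ℕ.* E ℕ.* ‖ P ‖    ∎)
  (begin
    ‖ shift r (quot r P) ‖         ≤⟨ ‖shift‖≤ r≤ (quot r P) ⟩
    S ℕ.* ‖ quot r P ‖             ≤⟨ ℕₚ.*-monoʳ-≤ S (‖quot‖≤ r≤ P) ⟩
    S ℕ.* (suc ρ ℕ.^ m ℕ.* ‖ P ‖) ≤⟨ ℕₚ.*-monoʳ-≤ S (ℕₚ.*-monoˡ-≤ ‖ P ‖ (ℕₚ.m≤n*m (suc ρ ℕ.^ m) (suc ρ))) ⟩
    S ℕ.* (E ℕ.* ‖ P ‖)           ≡⟨ sym (ℕₚ.*-assoc S E ‖ P ‖) ⟩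
    S ℕ.* E ℕ.* ‖ P ‖             ∎)
  where
  open ℕₚ.≤-Reasoning
  E = suc ρ ℕ.^ suc m
  S = shiftBound ρ m

-- Horner's scheme can be undone: the constant coefficient is P(r) - r y, where y, the value of the
-- tail at r, is the first coefficient of the quotient. The other coefficients follow from the tail
-- in the same way.
‖‖≤quot : ∀ {r ρ D} → ℤ.∣ r ∣ ℕ.≤ ρ → (P : Vec ℤ (suc m)) →
          ℤ.∣ evalℤ P r ∣ ℕ.≤ D → ‖ quot r P ‖ ℕ.≤ D → ‖ P ‖ ℕ.≤ suc ρ ℕ.* D
‖‖≤quot {r = r} {ρ} {D} r≤ (c ∷ []) e≤ q≤ = ‖‖-∷-lub c [] (begin
  ℤ.∣ c ∣                   ≡⟨ cong ℤ.∣_∣ (sym (trans (cong (λ z → c ℤ.+ z) (ℤₚ.*-zeroʳ r)) (ℤₚ.+-identityʳ c))) ⟩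
  ℤ.∣ c ℤ.+ r ℤ.* ℤ.0ℤ ∣     ≤⟨ e≤ ⟩
  D                         ≤⟨ ℕₚ.m≤m+n D (ρ ℕ.* D) ⟩
  suc ρ ℕ.* D               ∎) z≤n
  where open ℕₚ.≤-Reasoning
‖‖≤quot {r = r} {ρ} {D} r≤ (c ∷ cs@(_ ∷ _)) e≤ q≤ = ‖‖-∷-lub c cs
  (begin
    ℤ.∣ c ∣                        ≡⟨ cong ℤ.∣_∣ (solve 3 (λ c r y → c := (c :+ r :* y) :+ (:- r) :* y) refl c r y) ⟩
    ℤ.∣ c ℤ.+ r ℤ.* y ℤ.+ (ℤ.- r) ℤ.* y ∣
      ≤⟨ ∣c+ry∣≤ (c ℤ.+ r ℤ.* y) (ℤ.- r) y (subst (ℕ._≤ ρ) (sym (ℤₚ.∣-i∣≡∣i∣ r)) r≤) e≤ y≤ ⟩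
    D ℕ.+ ρ ℕ.* D ∎)
  (‖‖≤quot r≤ cs y≤ (ℕₚ.≤-trans (‖tail‖≤‖‖ y (quot r cs)) q≤))
  where
  open ℕₚ.≤-Reasoning
  open ℤSolver.+-*-Solver
  y = evalℤ cs r
  y≤ = ℕₚ.≤-trans (∣head∣≤‖‖ y (quot r cs)) q≤

‖‖≤shift : ∀ {r ρ} → ℤ.∣ r ∣ ℕ.≤ ρ → (P : Vec ℤ m) → ‖ P ‖ ℕ.≤ suc ρ ℕ.^ m ℕ.* ‖ shift r P ‖
‖‖≤shift {zero} r≤ [] = z≤n
‖‖≤shift {suc m} {r} {ρ} r≤ P = begin
  ‖ P ‖                         ≤⟨ ‖‖≤quot r≤ P
     (ℕₚ.≤-trans (∣head∣≤‖‖ (evalℤ P r) sq) (ℕₚ.m≤n*m D E {{ℕ.>-nonZero (1≤^ ρ m)}}))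
     (ℕₚ.≤-trans (‖‖≤shift r≤ (quot r P)) (ℕₚ.*-monoʳ-≤ E (‖tail‖≤‖‖ (evalℤ P r) sq))) ⟩
  suc ρ ℕ.* (E ℕ.* D)           ≡⟨ sym (ℕₚ.*-assoc (suc ρ) E D) ⟩
  suc ρ ℕ.^ suc m ℕ.* D         ∎
  where
  open ℕₚ.≤-Reasoning
  E = suc ρ ℕ.^ m
  D = ‖ shift r P ‖
  sq = shift r (quot r P)

-- Interpolation at integer points

1≤∣-∣ : ∀ {x y} → x ≢ y → 1 ℕ.≤ ℤ.∣ x ℤ.- y ∣
1≤∣-∣ x≢y = ℕₚ.n≢0⇒n>0 (λ eq → x≢y (ℤₚ.i-j≡0⇒i≡j _ _ (ℤₚ.∣i∣≡0⇒i≡0 eq)))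

-- Each division by x − r costs a factor 2 for P(s) − P(r), and a factor
-- 1 + ρ for recovering P from the quotient.
interpolation : ∀ {ρ D} k (r : Fin (suc k) → ℤ) → Injective _≡_ _≡_ r → (∀ i → ℤ.∣ r i ∣ ℕ.≤ ρ) →
                (P : Poly k) → (∀ i → ℤ.∣ evalℤ P (r i) ∣ ℕ.≤ D) →
                ‖ P ‖ ℕ.≤ (suc ρ ℕ.* 2) ℕ.^ suc k ℕ.* D
interpolation {ρ} {D} k r inj r≤ P e≤ = begin
  ‖ P ‖                       ≤⟨ ‖‖≤quot (r≤ zero) P bound₀ (bound₁ k r inj r≤ P e≤) ⟩
  suc ρ ℕ.* (2 ℕ.* (X ℕ.* D)) ≡⟨ solve 3 (λ a X D → a :* (con 2 :* (X :* D)) := a :* con 2 :* X :* D) refl (suc ρ) X D ⟩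
  suc ρ ℕ.* 2 ℕ.* X ℕ.* D     ∎
  where
  open ℕₚ.≤-Reasoning
  open +-*-Solver
  X = (suc ρ ℕ.* 2) ℕ.^ k
  1≤X : 1 ℕ.≤ X
  1≤X = ℕₚ.m^n>0 (suc ρ ℕ.* 2) k
  bound₀ : ℤ.∣ evalℤ P (r zero) ∣ ℕ.≤ 2 ℕ.* (X ℕ.* D)
  bound₀ = ℕₚ.≤-trans (e≤ zero) (ℕₚ.≤-trans
    (ℕₚ.m≤n*m D _ {{ℕ.>-nonZero 1≤X}}) (ℕₚ.m≤n*m _ 2))
  bound₁ : ∀ {D} k (r : Fin (suc k) → ℤ) → Injective _≡_ _≡_ r → (∀ i → ℤ.∣ r i ∣ ℕ.≤ ρ) →
           (P : Poly k) → (∀ i → ℤ.∣ evalℤ P (r i) ∣ ℕ.≤ D) →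
           ‖ quot (r zero) P ‖ ℕ.≤ 2 ℕ.* ((suc ρ ℕ.* 2) ℕ.^ k ℕ.* D)
  bound₁ zero r inj r≤ (c ∷ []) e≤ = z≤n
  bound₁ {D} (suc k) r inj r≤ P e≤ = begin
    ‖ Q ‖                                         ≤⟨ interpolation k (r ∘ suc) (suc-injective ∘ inj) (r≤ ∘ suc) Q quot≤ ⟩
    (suc ρ ℕ.* 2) ℕ.^ suc k ℕ.* (2 ℕ.* D)         ≡⟨ solve 2 (λ X D → X :* (con 2 :* D) := con 2 :* (X :* D)) refl ((suc ρ ℕ.* 2) ℕ.^ suc k) D ⟩
    2 ℕ.* ((suc ρ ℕ.* 2) ℕ.^ suc k ℕ.* D)         ∎
    where
    Q = quot (r zero) P
    quot≤ : ∀ i → ℤ.∣ evalℤ Q (r (suc i)) ∣ ℕ.≤ 2 ℕ.* D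
    quot≤ i = begin
      -- Distinct integers differ by at least 1, so dividing P(s) - P(t) by s - t does not increase
      -- it.
      ℤ.∣ y ∣                                  ≤⟨ ℕₚ.m≤n*m ℤ.∣ y ∣ ℤ.∣ s ℤ.- t ∣ {{ℕ.>-nonZero (1≤∣-∣ s≢t)}} ⟩
      ℤ.∣ s ℤ.- t ∣ ℕ.* ℤ.∣ y ∣                 ≡⟨ sym (ℤₚ.abs-* (s ℤ.- t) y) ⟩
      ℤ.∣ (s ℤ.- t) ℤ.* y ∣                    ≡⟨ cong ℤ.∣_∣ (ℤ-solve (evalℤ P s) (evalℤ P t) _ (evalℤ-quot t s P)) ⟩
      ℤ.∣ evalℤ P s ℤ.- evalℤ P t ∣            ≤⟨ ℤₚ.∣i-j∣≤∣i∣+∣j∣ (evalℤ P s) (evalℤ P t) ⟩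
      ℤ.∣ evalℤ P s ∣ ℕ.+ ℤ.∣ evalℤ P t ∣       ≤⟨ ℕₚ.+-mono-≤ (e≤ (suc i)) (e≤ zero) ⟩
      D ℕ.+ D                                 ≡⟨ cong (D ℕ.+_) (sym (ℕₚ.+-identityʳ D)) ⟩
      2 ℕ.* D                                 ∎
      where
      s = r (suc i)
      t = r zero
      y = evalℤ Q s
      s≢t : s ≢ t
      s≢t eq with () ← inj eq
      ℤ-solve : ∀ a b c → a ≡ b ℤ.+ c → c ≡ a ℤ.- b
      ℤ-solve _ b c refl = S.solve 2 (λ b c → c S.:= (b S.:+ c) S.:- b) refl b c
        where module S = ℤSolver.+-*-Solver

module _ {a ℓ₁ ℓ₂} (O : TotalOrder a ℓ₁ ℓ₂) where
  open TotalOrder O using (_≤_) renaming (Carrier to A)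
  open Extrema O using (argmax; f[xs]≤f[argmax])

  maximum : ∀ {n} (f : Fin (suc n) → A) → ∃[ i ] (∀ j → f j ≤ f i)
  maximum f = argmax f zero (allFin _) ,
    λ j → All.lookup (f[xs]≤f[argmax] {f = f} zero (allFin _)) (∈-allFin j)

interpolation-index : ∀ {ρ} k (r : Fin (suc k) → ℤ) → Injective _≡_ _≡_ r → (∀ i → ℤ.∣ r i ∣ ℕ.≤ ρ) →
                      (P : Poly k) → ∃[ i ] (‖ P ‖ ℕ.≤ (suc ρ ℕ.* 2) ℕ.^ suc k ℕ.* ℤ.∣ evalℤ P (r i) ∣)
interpolation-index k r inj r≤ P = case maximum ℕₚ.≤-totalOrder (λ i → ℤ.∣ evalℤ P (r i) ∣) of
  λ { (i , ≤max) → i , interpolation k r inj r≤ P ≤max }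

-- Norms of reversed and scaled polynomials

module _ {M : ℕ} (1≤M : 1 ℕ.≤ M) where
  private instance
    M≢0 : ℕ.NonZero M
    M≢0 = ℕ.>-nonZero 1≤M

  ∣c*M^m∣ : ∀ c m → ℤ.∣ c ℤ.* + (M ℕ.^ m) ∣ ≡ ℤ.∣ c ∣ ℕ.* M ℕ.^ m
  ∣c*M^m∣ c m = ℤₚ.abs-* c (+ (M ℕ.^ m))

  ‖‖≤revScale : (P : Vec ℤ m) → ‖ P ‖ ℕ.≤ ‖ revScale M P ‖
  ‖‖≤revScale [] = z≤n
  ‖‖≤revScale {suc m} (c ∷ cs) = subst (‖ c ∷ cs ‖ ℕ.≤_)
    (sym (trans (‖∷ʳ‖ (revScale M cs) _) (ℕₚ.⊔-comm ‖ revScale M cs ‖ _)))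
    (ℕₚ.⊔-mono-≤ (subst (ℤ.∣ c ∣ ℕ.≤_) (sym (∣c*M^m∣ c m))
                    (ℕₚ.m≤m*n ℤ.∣ c ∣ (M ℕ.^ m) {{ℕₚ.m^n≢0 M m}}))
                  (‖‖≤revScale cs))

  -- No coefficient is multiplied by more than M^(m - 1). The factor M on the left stands for the
  -- missing power and avoids the subtraction, also for m = 0.
  ‖revScale‖*M≤ : (P : Vec ℤ m) → ‖ revScale M P ‖ ℕ.* M ℕ.≤ ‖ P ‖ ℕ.* M ℕ.^ m
  ‖revScale‖*M≤ [] = z≤n
  ‖revScale‖*M≤ {suc m} P@(c ∷ cs) = begin
    ‖ revScale M P ‖ ℕ.* M
      ≡⟨ cong (ℕ._* M) (trans (‖∷ʳ‖ (revScale M cs) _) (cong (‖ revScale M cs ‖ ℕ.⊔_) (∣c*M^m∣ c m))) ⟩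
    (‖ revScale M cs ‖ ℕ.⊔ ℤ.∣ c ∣ ℕ.* M ℕ.^ m) ℕ.* M
      ≡⟨ ℕₚ.*-distribʳ-⊔ M ‖ revScale M cs ‖ _ ⟩
    ‖ revScale M cs ‖ ℕ.* M ℕ.⊔ ℤ.∣ c ∣ ℕ.* M ℕ.^ m ℕ.* M
      ≤⟨ ℕₚ.⊔-lub
           (ℕₚ.≤-trans (‖revScale‖*M≤ cs) (ℕₚ.*-mono-≤ (‖tail‖≤‖‖ c cs) (ℕₚ.m≤n*m (M ℕ.^ m) M)))
           (begin
             ℤ.∣ c ∣ ℕ.* M ℕ.^ m ℕ.* M   ≡⟨ solve 3 (λ c x M → c :* x :* M := c :* (M :* x)) refl ℤ.∣ c ∣ (M ℕ.^ m) M ⟩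
             ℤ.∣ c ∣ ℕ.* M ℕ.^ suc m     ≤⟨ ℕₚ.*-monoˡ-≤ (M ℕ.^ suc m) (∣head∣≤‖‖ c cs) ⟩
             ‖ P ‖ ℕ.* M ℕ.^ suc m      ∎) ⟩
    ‖ P ‖ ℕ.* M ℕ.^ suc m ∎
    where
    open ℕₚ.≤-Reasoning
    open +-*-Solver

  ‖revScale‖≤ : (P : Vec ℤ m) → ‖ revScale M P ‖ ℕ.≤ M ℕ.^ m ℕ.* ‖ P ‖
  ‖revScale‖≤ {m} P = ℕₚ.≤-trans (ℕₚ.m≤m*n ‖ revScale M P ‖ M)
    (subst (‖ revScale M P ‖ ℕ.* M ℕ.≤_) (ℕₚ.*-comm ‖ P ‖ (M ℕ.^ m)) (‖revScale‖*M≤ P))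

  leadCoeff-revScale : ∀ k (P : Poly k) c cs → P ≡ c ∷ cs → ‖ P ‖ ℕ.≤ M ℕ.* ℤ.∣ c ∣ →
                       ℤ.∣ leadCoeff k (revScale M P) ∣ ≡ ‖ revScale M P ‖
  leadCoeff-revScale k .(c ∷ cs) c cs refl ‖P‖≤ = begin-equality
    ℤ.∣ leadCoeff k (revScale M (c ∷ cs)) ∣ ≡⟨ cong ℤ.∣_∣ (lookup-∷ʳ-fromℕ (revScale M cs) _) ⟩
    ℤ.∣ c ℤ.* + (M ℕ.^ k) ∣                ≡⟨ sym (ℕₚ.m≤n⇒m⊔n≡n rest≤) ⟩
    ‖ revScale M cs ‖ ℕ.⊔ ℤ.∣ c ℤ.* + (M ℕ.^ k) ∣ ≡⟨ sym (‖∷ʳ‖ (revScale M cs) _) ⟩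
    ‖ revScale M (c ∷ cs) ‖                ∎
    where
    open ℕₚ.≤-Reasoning
    open +-*-Solver
    rest≤ : ‖ revScale M cs ‖ ℕ.≤ ℤ.∣ c ℤ.* + (M ℕ.^ k) ∣
    -- The coefficients below the top one fall short of M^k by a factor M, which is exactly what the
    -- bound on ‖P‖ demands.
    rest≤ = ℕₚ.*-cancelʳ-≤ _ _ M (begin
      ‖ revScale M cs ‖ ℕ.* M        ≤⟨ ‖revScale‖*M≤ cs ⟩
      ‖ cs ‖ ℕ.* M ℕ.^ k             ≤⟨ ℕₚ.*-monoˡ-≤ (M ℕ.^ k) (ℕₚ.≤-trans (‖tail‖≤‖‖ c cs) ‖P‖≤) ⟩
      M ℕ.* ℤ.∣ c ∣ ℕ.* M ℕ.^ k      ≡⟨ solve 3 (λ M c x → M :* c :* x := c :* x :* M) refl M ℤ.∣ c ∣ (M ℕ.^ k) ⟩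
      ℤ.∣ c ∣ ℕ.* M ℕ.^ k ℕ.* M      ≡⟨ cong (ℕ._* M) (sym (∣c*M^m∣ c k)) ⟩
      ℤ.∣ c ℤ.* + (M ℕ.^ k) ∣ ℕ.* M  ∎)

-- Infinite sets of polynomials

-- This form passes to images under maps that change norms by bounded factors only; the image is
-- then infinite without an argument about injectivity.
Unbounded : (Poly n → Set) → Set
Unbounded S = ∀ B → ∃[ P ] (S P × B ℕ.≤ ‖ P ‖)

interval : ℕ → List ℤ
interval B = map +_ (upTo (suc B)) ++ map -[1+_] (upTo B)

∈-interval : ∀ {B} z → ℤ.∣ z ∣ ℕ.≤ B → z ∈ interval B
∈-interval     (+ n)    n≤B = ∈-++⁺ˡ (∈-map⁺ +_ (∈-upTo⁺ (s≤s n≤B)))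
∈-interval {B} -[1+ n ] n<B = ∈-++⁺ʳ (map +_ (upTo (suc B))) (∈-map⁺ -[1+_] (∈-upTo⁺ n<B))

box : ∀ m → ℕ → List (Vec ℤ m)
box zero    B = [] ∷ []
box (suc m) B = cartesianProductWith _∷_ (interval B) (box m B)

∈-box : ∀ {B} (P : Vec ℤ m) → ‖ P ‖ ℕ.≤ B → P ∈ box m B
∈-box []       _  = here refl
∈-box (c ∷ cs) ≤B = ∈-cartesianProductWith⁺ _∷_
  (∈-interval c (ℕₚ.≤-trans (∣head∣≤‖‖ c cs) ≤B)) (∈-box cs (ℕₚ.≤-trans (‖tail‖≤‖‖ c cs) ≤B))

norm-bound : (Ps : List (Poly n)) → ∃[ B ] (∀ {P} → P ∈ Ps → ‖ P ‖ ℕ.≤ B)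
norm-bound [] = 0 , λ ()
norm-bound (P ∷ Ps) with norm-bound Ps
... | B , ≤B = ‖ P ‖ ℕ.⊔ B , λ
  { (here refl) → ℕₚ.m≤m⊔n _ _
  ; (there P∈)  → ℕₚ.≤-trans (≤B P∈) (ℕₚ.m≤n⊔m ‖ P ‖ B) }

unbounded⇒infinite : {S : Poly n → Set} → Unbounded S → Infinite S
unbounded⇒infinite unb (Ps , S⊆) with norm-bound Ps
... | B , ≤B with unb (suc B)
...   | P , SP , B<P = ℕₚ.<⇒≱ B<P (≤B (S⊆ SP))

module Reals (lem : ExcludedMiddle 0ℓ) (ℝ : CompleteOrderedField) where
  open CompleteOrderedField ℝ
    renaming (refl to ≈-refl; sym to ≈-sym; trans to ≈-trans; zero to *-zero)
  open Exponents lem ℝ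
  open TotalOrder totalOrder using (poset)
    renaming (refl to ≤-refl; trans to ≤-trans; antisym to ≤-antisym; total to ≤-total; reflexive to ≤-reflexive)
  open Algebra.Properties.CommutativeSemiring.Exp commutativeSemiring
  private
    module Mult = Algebra.Properties.Semiring.Mult semiring
    module Ringₚ = Algebra.Properties.Ring ring
    module Max = Algebra.Construct.NaturalChoice.Max totalOrder
  open Relation.Binary.Reasoning.PartialOrder poset

  -- The embedding of ℤ

  fromℕ-+ : ∀ m n → fromℕᴿ (m ℕ.+ n) ≈ fromℕᴿ m + fromℕᴿ n
  fromℕ-+ = Mult.×-homo-+ 1#

  fromℕ-* : ∀ m n → fromℕᴿ (m ℕ.* n) ≈ fromℕᴿ m * fromℕᴿ n
  fromℕ-* = Mult.×1-homo-*

  fromℕ-1 : fromℕᴿ 1 ≈ 1#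
  fromℕ-1 = +-identityʳ 1#

  fromℤ-⊖ : ∀ m n → fromℤ (m ℤ.⊖ n) ≈ fromℕᴿ m - fromℕᴿ n
  fromℤ-⊖ m zero = ≈-sym (≈-trans (+-congˡ Ringₚ.-0#≈0#) (+-identityʳ _))
  fromℤ-⊖ zero (suc n) = ≈-sym (+-identityˡ _)
  fromℤ-⊖ (suc m) (suc n) = begin-equality
    fromℤ (suc m ℤ.⊖ suc n)             ≡⟨ cong fromℤ (ℤₚ.[1+m]⊖[1+n]≡m⊖n m n) ⟩
    fromℤ (m ℤ.⊖ n)                     ≈⟨ fromℤ-⊖ m n ⟩
    fromℕᴿ m - fromℕᴿ n                 ≈⟨ +-congʳ (+-identityˡ _) ⟨
    (0# + fromℕᴿ m) - fromℕᴿ n          ≈⟨ +-congʳ (+-congʳ (-‿inverseʳ 1#)) ⟨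
    (1# - 1# + fromℕᴿ m) - fromℕᴿ n     ≈⟨ +-congʳ (+-assoc 1# (- 1#) (fromℕᴿ m)) ⟩
    (1# + (- 1# + fromℕᴿ m)) - fromℕᴿ n ≈⟨ +-congʳ (+-congˡ (+-comm (- 1#) (fromℕᴿ m))) ⟩
    (1# + (fromℕᴿ m - 1#)) - fromℕᴿ n   ≈⟨ +-congʳ (+-assoc 1# (fromℕᴿ m) (- 1#)) ⟨
    ((1# + fromℕᴿ m) - 1#) - fromℕᴿ n   ≈⟨ +-assoc (1# + fromℕᴿ m) (- 1#) (- fromℕᴿ n) ⟩
    (1# + fromℕᴿ m) + (- 1# - fromℕᴿ n) ≈⟨ +-congˡ (Ringₚ.-‿+-comm 1# (fromℕᴿ n)) ⟩
    (1# + fromℕᴿ m) - (1# + fromℕᴿ n)   ∎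

  fromℤ-neg : ∀ a → fromℤ (ℤ.- a) ≈ - fromℤ a
  fromℤ-neg (+ zero)   = ≈-sym Ringₚ.-0#≈0#
  fromℤ-neg (+ suc n)  = ≈-refl
  fromℤ-neg -[1+ n ]   = ≈-sym (Ringₚ.-‿involutive _)

  fromℤ-+ : ∀ a b → fromℤ (a ℤ.+ b) ≈ fromℤ a + fromℤ b
  fromℤ-+ (+ m)    (+ n)    = fromℕ-+ m n
  fromℤ-+ (+ m)    -[1+ n ] = fromℤ-⊖ m (suc n)
  fromℤ-+ -[1+ m ] (+ n)    = ≈-trans (fromℤ-⊖ n (suc m)) (+-comm _ _)
  fromℤ-+ -[1+ m ] -[1+ n ] = begin-equality
    - fromℕᴿ (suc (suc (m ℕ.+ n)))          ≡⟨ cong (λ k → - fromℕᴿ (suc k)) (ℕₚ.+-suc m n) ⟨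
    - fromℕᴿ (suc m ℕ.+ suc n)              ≈⟨ -‿cong (fromℕ-+ (suc m) (suc n)) ⟩
    - (fromℕᴿ (suc m) + fromℕᴿ (suc n))     ≈⟨ Ringₚ.-‿+-comm _ _ ⟨
    - fromℕᴿ (suc m) - fromℕᴿ (suc n)       ∎

  fromℤ-+*+ : ∀ m n → fromℤ (+ m ℤ.* + n) ≈ fromℕᴿ m * fromℕᴿ n
  fromℤ-+*+ m n = ≈-trans (reflexive (cong fromℤ (sym (ℤₚ.pos-* m n)))) (fromℕ-* m n)

  fromℤ-* : ∀ a b → fromℤ (a ℤ.* b) ≈ fromℤ a * fromℤ b
  fromℤ-* (+ m)    (+ n)    = fromℤ-+*+ m n
  fromℤ-* (+ m)    -[1+ n ] = begin-equality
    fromℤ (+ m ℤ.* -[1+ n ])            ≡⟨ cong fromℤ (ℤₚ.neg-distribʳ-* (+ m) (+ suc n)) ⟨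
    fromℤ (ℤ.- (+ m ℤ.* + suc n))       ≈⟨ fromℤ-neg (+ m ℤ.* + suc n) ⟩
    - fromℤ (+ m ℤ.* + suc n)           ≈⟨ -‿cong (fromℤ-+*+ m (suc n)) ⟩
    - (fromℕᴿ m * fromℕᴿ (suc n))       ≈⟨ Ringₚ.-‿distribʳ-* _ _ ⟩
    fromℕᴿ m * - fromℕᴿ (suc n)         ∎
  fromℤ-* -[1+ m ] b = begin-equality
    fromℤ (-[1+ m ] ℤ.* b)              ≡⟨ cong fromℤ (ℤₚ.neg-distribˡ-* (+ suc m) b) ⟨
    fromℤ (ℤ.- (+ suc m ℤ.* b))         ≈⟨ fromℤ-neg (+ suc m ℤ.* b) ⟩
    - fromℤ (+ suc m ℤ.* b)             ≈⟨ -‿cong (helper b) ⟩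
    - (fromℕᴿ (suc m) * fromℤ b)        ≈⟨ Ringₚ.-‿distribˡ-* _ _ ⟩
    - fromℕᴿ (suc m) * fromℤ b          ∎
    where
    helper : ∀ b → fromℤ (+ suc m ℤ.* b) ≈ fromℕᴿ (suc m) * fromℤ b
    helper (+ n)    = fromℤ-+*+ (suc m) n
    helper -[1+ n ] = fromℤ-* (+ suc m) -[1+ n ]

  private
    -- The ring solver compares coefficients while normalising, so these are taken from ℤ, where
    -- equality is computable.
    ℤ⟶ℝ : CommutativeRing.rawRing ℤₚ.+-*-commutativeRing -Raw-AlmostCommutative⟶ fromCommutativeRing commutativeRing
    ℤ⟶ℝ = record
      { ⟦_⟧ = fromℤ ; +-homo = fromℤ-+ ; *-homo = fromℤ-* ; -‿homo = fromℤ-neg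
      ; 0-homo = ≈-refl ; 1-homo = fromℕ-1 }

    fromℤ-≈? : ∀ a b → Maybe (fromℤ a ≈ fromℤ b)
    fromℤ-≈? a b with a ℤₚ.≟ b
    ... | yes a≡b = just (reflexive (cong fromℤ a≡b))
    ... | no  _   = nothing

  open Algebra.Solver.Ring _ _ ℤ⟶ℝ fromℤ-≈?
    using (solve; _:=_; _:+_; _:*_; _:-_; :-_; con)

  -- Ordered fields

  +-mono-≤ : ∀ {a b c d} → a ≤ b → c ≤ d → a + c ≤ b + d
  +-mono-≤ {a} {b} {c} {d} a≤b c≤d = begin
    a + c ≤⟨ +-monoˡ-≤ c a≤b ⟩
    b + c ≈⟨ +-comm b c ⟩
    c + b ≤⟨ +-monoˡ-≤ b c≤d ⟩
    d + b ≈⟨ +-comm d b ⟩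
    b + d ∎

  +-monoʳ-≤ : ∀ z {x y} → x ≤ y → z + x ≤ z + y
  +-monoʳ-≤ z = +-mono-≤ (≤-refl {z})

  +-cancelʳ-≤ : ∀ z {x y} → x + z ≤ y + z → x ≤ y
  +-cancelʳ-≤ z {x} {y} p = begin
    x               ≈⟨ solve 2 (λ x z → x := x :+ z :- z) ≈-refl x z ⟩
    x + z - z       ≤⟨ +-monoˡ-≤ (- z) p ⟩
    y + z - z       ≈⟨ solve 2 (λ x z → x :+ z :- z := x) ≈-refl y z ⟩
    y               ∎

  0≤-⇒≤ : ∀ {x y} → 0# ≤ y - x → x ≤ y
  0≤-⇒≤ {x} {y} p = begin
    x         ≈⟨ +-identityˡ x ⟨
    0# + x    ≤⟨ +-monoˡ-≤ x p ⟩
    y - x + x ≈⟨ solve 2 (λ x y → y :- x :+ x := y) ≈-refl x y ⟩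
    y         ∎

  ≤⇒0≤- : ∀ {x y} → x ≤ y → 0# ≤ y - x
  ≤⇒0≤- {x} {y} p = begin
    0#    ≈⟨ -‿inverseʳ x ⟨
    x - x ≤⟨ +-monoˡ-≤ (- x) p ⟩
    y - x ∎

  neg-mono-≤ : ∀ {x y} → x ≤ y → - y ≤ - x
  neg-mono-≤ {x} {y} p = 0≤-⇒≤ (begin
    0#        ≤⟨ ≤⇒0≤- p ⟩
    y - x     ≈⟨ solve 2 (λ x y → y :- x := :- x :- :- y) ≈-refl x y ⟩
    - x - - y ∎)

  ≤0⇒0≤- : ∀ {x} → x ≤ 0# → 0# ≤ - x
  ≤0⇒0≤- {x} p = begin
    0#     ≈⟨ Ringₚ.-0#≈0# ⟨
    - 0#   ≤⟨ neg-mono-≤ p ⟩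
    - x    ∎

  *-monoʳ-≤ : ∀ {z x y} → 0# ≤ z → x ≤ y → z * x ≤ z * y
  *-monoʳ-≤ {z} {x} {y} 0≤z x≤y = 0≤-⇒≤ (begin
    0#            ≤⟨ *-nonNeg 0≤z (≤⇒0≤- x≤y) ⟩
    z * (y - x)   ≈⟨ solve 3 (λ x y z → z :* (y :- x) := z :* y :- z :* x) ≈-refl x y z ⟩
    z * y - z * x ∎)

  *-monoˡ-≤ : ∀ {z x y} → 0# ≤ z → x ≤ y → x * z ≤ y * z
  *-monoˡ-≤ {z} {x} {y} 0≤z x≤y = begin
    x * z ≈⟨ *-comm x z ⟩
    z * x ≤⟨ *-monoʳ-≤ 0≤z x≤y ⟩
    z * y ≈⟨ *-comm z y ⟩
    y * z ∎

  *-mono-≤ : ∀ {a b c d} → 0# ≤ b → 0# ≤ c → a ≤ b → c ≤ d → a * c ≤ b * d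
  *-mono-≤ 0≤b 0≤c a≤b c≤d = ≤-trans (*-monoˡ-≤ 0≤c a≤b) (*-monoʳ-≤ 0≤b c≤d)

  0≤1 : 0# ≤ 1#
  0≤1 with ≤-total 0# 1#
  ... | inj₁ p = p
  ... | inj₂ p = begin
    0#          ≤⟨ *-nonNeg (≤0⇒0≤- p) (≤0⇒0≤- p) ⟩
    - 1# * - 1# ≈⟨ solve 1 (λ x → (:- x) :* (:- x) := x :* x) ≈-refl 1# ⟩
    1# * 1#     ≈⟨ *-identityˡ 1# ⟩
    1#          ∎

  1≰0 : ¬ (1# ≤ 0#)
  1≰0 p = 0≉1 (≤-antisym 0≤1 p)

  x≤x+1 : ∀ x → x ≤ x + 1#
  x≤x+1 x = begin
    x      ≈⟨ +-identityʳ x ⟨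
    x + 0# ≤⟨ +-monoʳ-≤ x 0≤1 ⟩
    x + 1# ∎

  x+1≰x : ∀ {x} → ¬ (x + 1# ≤ x)
  x+1≰x {x} p = 1≰0 (+-cancelʳ-≤ x (begin
    1# + x ≈⟨ +-comm 1# x ⟩
    x + 1# ≤⟨ p ⟩
    x      ≈⟨ +-identityˡ x ⟨
    0# + x ∎))

  ≰⇒≥ : ∀ {x y} → ¬ (x ≤ y) → y ≤ x
  ≰⇒≥ {x} {y} x≰y with ≤-total x y
  ... | inj₁ p = contradiction p x≰y
  ... | inj₂ p = p

  ≤-≈-trans : ∀ {x y z} → x ≤ y → y ≈ z → x ≤ z
  ≤-≈-trans p q = ≤-trans p (≤-reflexive q)

  ≈-≤-trans : ∀ {x y z} → x ≈ y → y ≤ z → x ≤ z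
  ≈-≤-trans p q = ≤-trans (≤-reflexive p) q

  0≤fromℕ : ∀ n → 0# ≤ fromℕᴿ n
  0≤fromℕ zero    = ≤-refl
  0≤fromℕ (suc n) = begin
    0#             ≈⟨ +-identityˡ 0# ⟨
    0# + 0#        ≤⟨ +-mono-≤ 0≤1 (0≤fromℕ n) ⟩
    1# + fromℕᴿ n  ∎

  fromℕ-mono-≤ : ∀ {m n} → m ℕ.≤ n → fromℕᴿ m ≤ fromℕᴿ n
  fromℕ-mono-≤ (z≤n {n}) = 0≤fromℕ n
  fromℕ-mono-≤ (s≤s m≤n) = +-monoʳ-≤ 1# (fromℕ-mono-≤ m≤n)

  fromℕ-cancel-≤ : ∀ {m n} → fromℕᴿ m ≤ fromℕᴿ n → m ℕ.≤ n
  fromℕ-cancel-≤ {m} {n} p = ℕₚ.≮⇒≥ λ n<m → x+1≰x (begin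
    fromℕᴿ n + 1#   ≈⟨ +-comm _ _ ⟩
    fromℕᴿ (suc n)  ≤⟨ fromℕ-mono-≤ n<m ⟩
    fromℕᴿ m        ≤⟨ p ⟩
    fromℕᴿ n        ∎)

  1≤fromℕ : ∀ {n} → 1 ℕ.≤ n → 1# ≤ fromℕᴿ n
  1≤fromℕ 1≤n = ≈-≤-trans (≈-sym fromℕ-1) (fromℕ-mono-≤ 1≤n)

  Positive : Carrier → Set
  Positive x = 0# ≤ x × ¬ (x ≈ 0#)

  1≤⇒positive : ∀ {x} → 1# ≤ x → Positive x
  1≤⇒positive p = ≤-trans 0≤1 p , λ x≈0 → 1≰0 (≤-≈-trans p x≈0)

  fromℕ-positive : ∀ {n} → 1 ℕ.≤ n → Positive (fromℕᴿ n)
  fromℕ-positive = 1≤⇒positive ∘ 1≤fromℕ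

  ⁻¹-inverseˡ : ∀ {x} → ¬ (x ≈ 0#) → x ⁻¹ * x ≈ 1#
  ⁻¹-inverseˡ x≉0 = ≈-trans (*-comm _ _) (⁻¹-inverseʳ x≉0)

  *-cancelʳ-≈ : ∀ {x y z} → ¬ (z ≈ 0#) → x * z ≈ y * z → x ≈ y
  *-cancelʳ-≈ {x} {y} {z} z≉0 p = begin-equality
    x              ≈⟨ undo x ⟨
    x * z * z ⁻¹   ≈⟨ *-congʳ p ⟩
    y * z * z ⁻¹   ≈⟨ undo y ⟩
    y              ∎
    where
    undo : ∀ x → x * z * z ⁻¹ ≈ x
    undo x = ≈-trans (*-assoc x z (z ⁻¹)) (≈-trans (*-congˡ (⁻¹-inverseʳ z≉0)) (*-identityʳ x))

  *-cancelʳ-≤ : ∀ {x y z} → Positive z → x * z ≤ y * z → x ≤ y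
  *-cancelʳ-≤ {x} {y} (0≤z , z≉0) p with ≤-total x y
  ... | inj₁ x≤y = x≤y
  ... | inj₂ y≤x = ≤-reflexive (*-cancelʳ-≈ z≉0 (≤-antisym p (*-monoˡ-≤ 0≤z y≤x)))

  *-≉0 : ∀ {x y} → ¬ (x ≈ 0#) → ¬ (y ≈ 0#) → ¬ (x * y ≈ 0#)
  *-≉0 {x} {y} x≉0 y≉0 p = x≉0 (*-cancelʳ-≈ y≉0 (≈-trans p (≈-sym (zeroˡ y))))

  *-positive : ∀ {x y} → Positive x → Positive y → Positive (x * y)
  *-positive (0≤x , x≉0) (0≤y , y≉0) = *-nonNeg 0≤x 0≤y , *-≉0 x≉0 y≉0

  1-positive : Positive 1#
  1-positive = 1≤⇒positive ≤-refl

  ^-positive : ∀ {x} n → Positive x → Positive (x ^ n)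
  ^-positive zero    _  = 1-positive
  ^-positive (suc n) 0<x = *-positive 0<x (^-positive n 0<x)

  0≤^ : ∀ {x} n → 0# ≤ x → 0# ≤ x ^ n
  0≤^ zero    _   = 0≤1
  0≤^ (suc n) 0≤x = *-nonNeg 0≤x (0≤^ n 0≤x)

  ^-monoˡ-≤ : ∀ {x y} n → 0# ≤ x → x ≤ y → x ^ n ≤ y ^ n
  ^-monoˡ-≤ zero    0≤x x≤y = ≤-refl
  ^-monoˡ-≤ (suc n) 0≤x x≤y = *-mono-≤ (≤-trans 0≤x x≤y) (0≤^ n 0≤x) x≤y (^-monoˡ-≤ n 0≤x x≤y)

  1≤^ᴿ : ∀ {b} n → 1# ≤ b → 1# ≤ b ^ n
  1≤^ᴿ zero    1≤b = ≤-refl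
  1≤^ᴿ {b} (suc n) 1≤b = begin
    1#         ≈⟨ *-identityˡ 1# ⟨
    1# * 1#    ≤⟨ *-mono-≤ (≤-trans 0≤1 1≤b) 0≤1 1≤b (1≤^ᴿ n 1≤b) ⟩
    b * b ^ n  ∎

  ^-monoʳ-≤ : ∀ {b m n} → 1# ≤ b → m ℕ.≤ n → b ^ m ≤ b ^ n
  ^-monoʳ-≤ {n = n} 1≤b z≤n = 1≤^ᴿ n 1≤b
  ^-monoʳ-≤ 1≤b (s≤s m≤n)   = *-monoʳ-≤ (≤-trans 0≤1 1≤b) (^-monoʳ-≤ 1≤b m≤n)

  ^-cancel-≤ : ∀ {x y} n → 0# ≤ x → 0# ≤ y → x ^ suc n ≤ y ^ suc n → x ≤ y
  ^-cancel-≤ {x} {y} n 0≤x 0≤y p with ≤-total x y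
  ... | inj₁ x≤y = x≤y
  ... | inj₂ y≤x with lem {x ≈ 0#}
  ...   | yes x≈0 = ≈-≤-trans x≈0 0≤y
  ...   | no  x≉0 = *-cancelʳ-≤ (^-positive n (0≤x , x≉0)) (begin
    x * x ^ n  ≤⟨ p ⟩
    y * y ^ n  ≤⟨ *-monoʳ-≤ 0≤y (^-monoˡ-≤ n 0≤y y≤x) ⟩
    y * x ^ n  ∎)

  1^≈1 : ∀ n → 1# ^ n ≈ 1#
  1^≈1 zero    = ≈-refl
  1^≈1 (suc n) = ≈-trans (*-identityˡ _) (1^≈1 n)

  -- If the natural numbers were bounded, they would have a least upper bound s; since n + 1 ≤ s for
  -- all n, also s - 1 would be an upper bound.
  archimedean : ∀ x → ∃[ n ] (x ≤ fromℕᴿ n)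
  archimedean x with lem {∃[ n ] (x ≤ fromℕᴿ n)}
  ... | yes p = p
  ... | no ¬p = contradiction s≤s-1 λ p → x+1≰x (begin
      s + 1#       ≤⟨ +-monoˡ-≤ 1# p ⟩
      s - 1# + 1#  ≈⟨ solve 2 (λ x y → y :- x :+ x := y) ≈-refl 1# s ⟩
      s            ∎)
    where
    Naturals : Pred Carrier 0ℓ
    Naturals y = ∃[ n ] (y ≈ fromℕᴿ n)
    lub = complete Naturals (0# , 0 , ≈-refl)
      (x , λ { (n , y≈n) → ≈-≤-trans y≈n (≰⇒≥ (λ x≤n → ¬p (n , x≤n))) })
    s = proj₁ lub
    s≤s-1 : s ≤ s - 1#
    s≤s-1 = proj₂ (proj₂ lub) λ { {y} (n , y≈n) → +-cancelʳ-≤ 1# (begin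
      y + 1#          ≈⟨ +-congʳ y≈n ⟩
      fromℕᴿ n + 1#   ≈⟨ +-comm _ _ ⟩
      fromℕᴿ (suc n)  ≤⟨ proj₁ (proj₂ lub) (suc n , ≈-refl) ⟩
      s               ≈⟨ solve 2 (λ x y → y :- x :+ x := y) ≈-refl 1# s ⟨
      s - 1# + 1#     ∎) }

  floor : ∀ {u} → 0# ≤ u → ∃[ j ] (fromℕᴿ j ≤ u × u ≤ fromℕᴿ (suc j))
  floor {u} 0≤u = search (suc N) λ N+1≤u → x+1≰x (begin
      fromℕᴿ N + 1#   ≈⟨ +-comm _ _ ⟩
      fromℕᴿ (suc N)  ≤⟨ N+1≤u ⟩
      u               ≤⟨ proj₂ (archimedean u) ⟩
      fromℕᴿ N        ∎)
    where
    N = proj₁ (archimedean u)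
    search : ∀ n → ¬ (fromℕᴿ n ≤ u) → ∃[ j ] (fromℕᴿ j ≤ u × u ≤ fromℕᴿ (suc j))
    search zero    n≰u = contradiction 0≤u n≰u
    search (suc n) n≰u with lem {fromℕᴿ n ≤ u}
    ... | yes n≤u = n , n≤u , ≰⇒≥ n≰u
    ... | no  n≰u = search n n≰u

  -- Fractions (p − q)/d are given by p, q and d, so that only natural
  -- exponents occur.
  between : ∀ {x y} → ¬ (y ≤ x) →
            ∃[ p ] ∃[ q ] ∃[ d ] (x * fromℕᴿ (suc d) + fromℕᴿ q ≤ fromℕᴿ p ×
                                  fromℕᴿ (suc p) ≤ y * fromℕᴿ (suc d) + fromℕᴿ q)
  between {x} {y} y≰x = suc j , q , d , proj₂ (proj₂ fl) , (begin
      1# + (1# + fromℕᴿ j)      ≤⟨ +-monoʳ-≤ 1# (+-monoʳ-≤ 1# (proj₁ (proj₂ fl))) ⟩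
      1# + (1# + (x * D + Q))   ≈⟨ solve 4 (λ i x D Q → i :+ (i :+ (x :* D :+ Q)) := (i :+ i) :+ x :* D :+ Q) ≈-refl 1# x D Q ⟩
      (1# + 1#) + x * D + Q     ≤⟨ +-monoˡ-≤ Q (+-monoˡ-≤ (x * D) gap) ⟩
      D * (y - x) + x * D + Q   ≈⟨ solve 4 (λ x y D Q → D :* (y :- x) :+ x :* D :+ Q := y :* D :+ Q) ≈-refl x y D Q ⟩
      y * D + Q                 ∎)
    where
    0≤δ : 0# ≤ y - x
    0≤δ = ≤⇒0≤- (≰⇒≥ y≰x)
    δ≉0 : ¬ (y - x ≈ 0#)
    δ≉0 δ≈0 = y≰x (begin
      y          ≈⟨ solve 2 (λ x y → y := y :- x :+ x) ≈-refl x y ⟩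
      y - x + x  ≈⟨ +-congʳ δ≈0 ⟩
      0# + x     ≈⟨ +-identityˡ x ⟩
      x          ∎)
    -- The denominator D satisfies D (y - x) ≥ 2, so that two consecutive integers, j + 1 and j + 2,
    -- fit between x D + q and y D + q. The shift q makes x D + q non-negative, as `floor` requires.
    two/δ = (1# + 1#) * (y - x) ⁻¹
    d = proj₁ (archimedean two/δ)
    D = fromℕᴿ (suc d)
    gap : 1# + 1# ≤ D * (y - x)
    gap = begin
      1# + 1#                             ≈⟨ *-identityʳ _ ⟨
      (1# + 1#) * 1#                      ≈⟨ *-congˡ (⁻¹-inverseˡ δ≉0) ⟨
      (1# + 1#) * ((y - x) ⁻¹ * (y - x))  ≈⟨ *-assoc _ _ _ ⟨
      two/δ * (y - x)                     ≤⟨ *-monoˡ-≤ 0≤δ (≤-trans (proj₂ (archimedean two/δ)) (fromℕ-mono-≤ (ℕₚ.n≤1+n d))) ⟩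
      D * (y - x)                         ∎
    q = proj₁ (archimedean (- (x * D)))
    Q = fromℕᴿ q
    fl = floor {x * D + Q} (begin
      0#              ≈⟨ -‿inverseʳ (x * D) ⟨
      x * D - x * D   ≤⟨ +-monoʳ-≤ (x * D) (proj₂ (archimedean (- (x * D)))) ⟩
      x * D + Q       ∎)
    j = proj₁ fl

  midpoint : ∀ {x y} → ¬ (y ≤ x) → ∃[ z ] (¬ (z ≤ x) × ¬ (y ≤ z))
  midpoint {x} {y} y≰x = z ,
    (λ z≤x → y≰x (+-cancelʳ-≤ x (begin
      y + x  ≈⟨ ≈-trans (+-comm y x) (≈-sym z+z) ⟩
      z + z  ≤⟨ +-mono-≤ z≤x z≤x ⟩
      x + x  ∎))) ,
    (λ y≤z → y≰x (+-cancelʳ-≤ y (begin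
      y + y  ≤⟨ +-mono-≤ y≤z y≤z ⟩
      z + z  ≈⟨ z+z ⟩
      x + y  ∎)))
    where
    2≉0 : ¬ (1# + 1# ≈ 0#)
    2≉0 = proj₂ (1≤⇒positive (x≤x+1 1#))
    h = (1# + 1#) ⁻¹
    z = (x + y) * h
    z+z : z + z ≈ x + y
    z+z = begin-equality
      z + z                  ≈⟨ +-cong (*-identityʳ z) (*-identityʳ z) ⟨
      z * 1# + z * 1#        ≈⟨ solve 3 (λ a h i → (a :* h) :* i :+ (a :* h) :* i := a :* ((i :+ i) :* h)) ≈-refl (x + y) h 1# ⟩
      (x + y) * ((1# + 1#) * h) ≈⟨ *-congˡ (⁻¹-inverseʳ 2≉0) ⟩
      (x + y) * 1#           ≈⟨ *-identityʳ _ ⟩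
      x + y                  ∎

  -- Suprema

  sup-isLUB : ∀ {S} → Satisfiable S → Satisfiable (UpperBound S) → IsLUB S (real (sup S))
  sup-isLUB {S} nonempty bounded with lem {Satisfiable S} | lem {Satisfiable (UpperBound S)}
  ... | no  ¬p | _      = contradiction nonempty ¬p
  ... | yes _  | no  ¬q = contradiction bounded ¬q
  ... | yes p  | yes q  = proj₂ (complete S p q)

  -- For T closed downwards, this says that sup S ≤ sup T.
  infix 4 _⊑_
  _⊑_ : Pred Carrier 0ℓ → Pred Carrier 0ℓ → Set
  S ⊑ T = ∀ {w w′} → S w → ¬ (w ≤ w′) → T w′

  ⊑-nonempty : ∀ {S T} → S ⊑ T → Satisfiable S → Satisfiable T
  ⊑-nonempty S⊑T (w , Sw) = w - 1# , S⊑T Sw λ w≤w-1 → x+1≰x (begin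
    w + 1#       ≤⟨ +-monoˡ-≤ 1# w≤w-1 ⟩
    w - 1# + 1#  ≈⟨ solve 2 (λ x y → y :- x :+ x := y) ≈-refl 1# w ⟩
    w            ∎)

  ⊑-bound : ∀ {S T b} → S ⊑ T → UpperBound T b → UpperBound S b
  ⊑-bound {b = b} S⊑T ub {w} Sw with lem {w ≤ b}
  ... | yes w≤b = w≤b
  ... | no  w≰b = case midpoint w≰b of λ { (z , z≰b , w≰z) → contradiction (ub (S⊑T Sw w≰z)) z≰b }

  ⊑-trans : ∀ {S T U} → S ⊑ T → T ⊑ U → S ⊑ U
  ⊑-trans S⊑T T⊑U Sw w≰w′ = case midpoint w≰w′ of λ { (z , z≰w′ , w≰z) → T⊑U (S⊑T Sw w≰z) z≰w′ }

  -- The cases are those in the definition of `sup`. Nonemptiness and upper bounds pass along `_⊑_`,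
  -- which rules out the mixed cases and bounds each finite supremum by the other.
  sup-cong : ∀ {S T} → S ⊑ T → T ⊑ S → sup S ≈± sup T
  sup-cong {S} {T} S⊑T T⊑S
    with lem {Satisfiable S} | lem {Satisfiable (UpperBound S)}
       | lem {Satisfiable T} | lem {Satisfiable (UpperBound T)}
  ... | no  _  | _      | no  _  | _      = E.⊥±≈⊥±
  ... | no ¬s  | _      | yes t  | _      = contradiction (⊑-nonempty T⊑S t) ¬s
  ... | yes s  | _      | no ¬t  | _      = contradiction (⊑-nonempty S⊑T s) ¬t
  ... | yes _  | no  _  | yes _  | no  _  = E.⊤±≈⊤±
  ... | yes _  | no ¬b  | yes _  | yes (b , ub) = contradiction (b , λ {x} → ⊑-bound S⊑T ub {x}) ¬b
  ... | yes _  | yes (b , ub) | yes _ | no ¬b = contradiction (b , λ {x} → ⊑-bound T⊑S ub {x}) ¬b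
  ... | yes s  | yes bs | yes t  | yes bt = E.[ ≤-antisym
      (proj₂ (proj₂ (complete S s bs)) (λ {x} → ⊑-bound S⊑T (proj₁ (proj₂ (complete T t bt))) {x}))
      (proj₂ (proj₂ (complete T t bt)) (λ {x} → ⊑-bound T⊑S (proj₁ (proj₂ (complete S s bs))) {x})) ]

  -- Real powers

  -- An integer power becomes a quotient of two natural powers, so that negative exponents and
  -- inverses disappear from the comparisons below.
  ^ℤ-split : ∀ {b} → ¬ (b ≈ 0#) → ∀ n →
             ∃[ u ] ∃[ v ] (fromℤ n + fromℕᴿ v ≈ fromℕᴿ u × (b ^ℤ n) * b ^ v ≈ b ^ u)
  ^ℤ-split b≉0 (+ n) = n , 0 , +-identityʳ _ , *-identityʳ _
  ^ℤ-split {b} b≉0 -[1+ n ] = 0 , suc n , -‿inverseˡ _ , (begin-equality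
    (b ⁻¹) ^ suc n * b ^ suc n  ≈⟨ ^-distrib-* (b ⁻¹) b (suc n) ⟨
    (b ⁻¹ * b) ^ suc n          ≈⟨ ^-congˡ (suc n) (⁻¹-inverseˡ b≉0) ⟩
    1# ^ suc n                  ≈⟨ 1^≈1 (suc n) ⟩
    1#                          ∎)

  ^-swap : ∀ x m n → (x ^ m) ^ n ≈ (x ^ n) ^ m
  ^-swap x m n = begin-equality
    (x ^ m) ^ n   ≈⟨ ^-assocʳ x m n ⟩
    x ^ (m ℕ.* n) ≡⟨ cong (x ^_) (ℕₚ.*-comm m n) ⟩
    x ^ (n ℕ.* m) ≈⟨ ^-assocʳ x n m ⟨
    (x ^ n) ^ m   ∎

  -- If y ≤ b^((u − v)/(e + 1)) and (u − v)/(e + 1) ≤ (p − q)/d, then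
  -- y ≤ b^((p − q)/d).
  root-≤ : ∀ {b y} → 1# ≤ b → 0# ≤ y → ∀ e u v d p q →
           y ^ suc e * b ^ v ≤ b ^ u →
           u ℕ.* d ℕ.+ q ℕ.* suc e ℕ.≤ p ℕ.* suc e ℕ.+ v ℕ.* d →
           y ^ d * b ^ q ≤ b ^ p
  root-≤ {b} {y} 1≤b 0≤y e′ u v d p q y^e≤ exps = ^-cancel-≤ e′
    (*-nonNeg (0≤^ d 0≤y) (0≤^ q 0≤b)) (0≤^ p 0≤b)
    -- After passing to e-th powers, the factor `b ^ (v * d)` completes `y ^ e` to the d-th power of
    -- the left side of `y^e≤`.
    (*-cancelʳ-≤ (^-positive (v ℕ.* d) (1≤⇒positive 1≤b)) (begin
      (y ^ d * b ^ q) ^ e * b ^ (v ℕ.* d)              ≈⟨ *-congʳ (^-distrib-* (y ^ d) (b ^ q) e) ⟩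
      (y ^ d) ^ e * (b ^ q) ^ e * b ^ (v ℕ.* d)        ≈⟨ *-cong (*-cong (^-swap y d e) (^-assocʳ b q e)) (≈-sym (^-assocʳ b v d)) ⟩
      (y ^ e) ^ d * b ^ (q ℕ.* e) * (b ^ v) ^ d        ≈⟨ solve 3 (λ x y z → x :* y :* z := (x :* z) :* y) ≈-refl ((y ^ e) ^ d) (b ^ (q ℕ.* e)) ((b ^ v) ^ d) ⟩
      ((y ^ e) ^ d * (b ^ v) ^ d) * b ^ (q ℕ.* e)      ≈⟨ *-congʳ (^-distrib-* (y ^ e) (b ^ v) d) ⟨
      (y ^ e * b ^ v) ^ d * b ^ (q ℕ.* e)              ≤⟨ *-monoˡ-≤ (0≤^ (q ℕ.* e) 0≤b) (^-monoˡ-≤ d (*-nonNeg (0≤^ e 0≤y) (0≤^ v 0≤b)) y^e≤) ⟩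
      (b ^ u) ^ d * b ^ (q ℕ.* e)                      ≈⟨ *-congʳ (^-assocʳ b u d) ⟩
      b ^ (u ℕ.* d) * b ^ (q ℕ.* e)                    ≈⟨ ^-homo-* b (u ℕ.* d) (q ℕ.* e) ⟨
      b ^ (u ℕ.* d ℕ.+ q ℕ.* e)                        ≤⟨ ^-monoʳ-≤ 1≤b exps ⟩
      b ^ (p ℕ.* e ℕ.+ v ℕ.* d)                        ≈⟨ ^-homo-* b (p ℕ.* e) (v ℕ.* d) ⟩
      b ^ (p ℕ.* e) * b ^ (v ℕ.* d)                    ≈⟨ *-congʳ (^-assocʳ b p e) ⟨
      (b ^ p) ^ e * b ^ (v ℕ.* d)                      ∎))
    where
    e = suc e′
    0≤b = ≤-trans 0≤1 1≤b

  PowerSet : Carrier → Carrier → Pred Carrier 0ℓ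
  PowerSet b x y = 0# ≤ y × (∃[ q ] (fromℚ q ≤ x × y ^ ℚ.denominatorℕ q ≤ b ^ℤ ℚ.numerator q))

  fromℕ-linear : ∀ a b c d → fromℕᴿ (a ℕ.* b ℕ.+ c ℕ.* d) ≈ fromℕᴿ a * fromℕᴿ b + fromℕᴿ c * fromℕᴿ d
  fromℕ-linear a b c d = ≈-trans (fromℕ-+ (a ℕ.* b) (c ℕ.* d)) (+-cong (fromℕ-* a b) (fromℕ-* c d))

  -- Membership is used through fractions (p - q)/d ≥ x and established, in `powerSet⇐`, through
  -- fractions (p - q)/d ≤ x. In both, the rational hidden in `PowerSet` is compared with the
  -- fraction by cross-multiplication.
  powerSet⇒ : ∀ {b x y} → 1# ≤ b → PowerSet b x y → ∀ d p q →
              x * fromℕᴿ d + fromℕᴿ q ≤ fromℕᴿ p → y ^ d * b ^ q ≤ b ^ p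
  powerSet⇒ {b} {x} {y} 1≤b (0≤y , r@(ℚ.mkℚ n e-1 _) , r≤x , y^e≤) d p q xd+q≤p
    with ^ℤ-split (proj₂ (1≤⇒positive 1≤b)) n
  ... | u , v , n+v≈u , b^n = root-≤ 1≤b 0≤y e-1 u v d p q
    (≤-≈-trans (*-monoˡ-≤ (0≤^ v (≤-trans 0≤1 1≤b)) y^e≤) b^n)
    (fromℕ-cancel-≤ (begin
      fromℕᴿ (u ℕ.* d ℕ.+ q ℕ.* e)  ≈⟨ fromℕ-linear u d q e ⟩
      fromℕᴿ u * D + Q * E          ≈⟨ +-congʳ (*-congʳ n+v≈u) ⟨
      (N + V) * D + Q * E           ≤⟨ +-monoˡ-≤ (Q * E) (*-monoˡ-≤ (0≤fromℕ d) (+-monoˡ-≤ V N≤xE)) ⟩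
      (x * E + V) * D + Q * E       ≈⟨ solve 5 (λ x E V D Q → (x :* E :+ V) :* D :+ Q :* E := (x :* D :+ Q) :* E :+ V :* D) ≈-refl x E V D Q ⟩
      (x * D + Q) * E + V * D       ≤⟨ +-monoˡ-≤ (V * D) (*-monoˡ-≤ (0≤fromℕ e) xd+q≤p) ⟩
      fromℕᴿ p * E + V * D          ≈⟨ fromℕ-linear p e v d ⟨
      fromℕᴿ (p ℕ.* e ℕ.+ v ℕ.* d)  ∎))
    where
    e = suc e-1
    E = fromℕᴿ e
    D = fromℕᴿ d
    Q = fromℕᴿ q
    V = fromℕᴿ v
    N = fromℤ n
    N≤xE : N ≤ x * E
    N≤xE = begin
      N               ≈⟨ *-identityʳ N ⟨
      N * 1#          ≈⟨ *-congˡ (⁻¹-inverseˡ (proj₂ (fromℕ-positive {e} (s≤s z≤n)))) ⟨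
      N * (E ⁻¹ * E)  ≈⟨ *-assoc N _ E ⟨
      fromℚ r * E     ≤⟨ *-monoˡ-≤ (0≤fromℕ e) r≤x ⟩
      x * E           ∎

  powerSet⇐ : ∀ {b x y} → 1# ≤ b → 0# ≤ y → ∀ d-1 p q →
              fromℕᴿ p ≤ x * fromℕᴿ (suc d-1) + fromℕᴿ q →
              y ^ suc d-1 * b ^ q ≤ b ^ p → PowerSet b x y
  powerSet⇐ {b} {x} {y} 1≤b 0≤y d-1 p q p≤xd+q y^d≤
    -- A rational is stored in lowest terms, so (p - q)/d turns into some n/e. By `cross` the two
    -- are equal, and the condition on exponents in `root-≤` holds with equality.
    with fraction (p ℤ.⊖ q) (suc d-1)
  ... | r@(ℚ.mkℚ n e-1 _) , cross with ^ℤ-split (proj₂ (1≤⇒positive 1≤b)) n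
  ...   | u , v , n+v≈u , b^n = 0≤y , r , r≤x ,
    *-cancelʳ-≤ (^-positive v (1≤⇒positive 1≤b)) (≤-≈-trans
      (root-≤ 1≤b 0≤y d-1 p q e u v y^d≤ (fromℕ-cancel-≤ (≤-reflexive (begin-equality
        fromℕᴿ (p ℕ.* e ℕ.+ v ℕ.* d)  ≈⟨ fromℕ-linear p e v d ⟩
        P * E + V * D                 ≈⟨ solve 5 (λ P E V D Q → P :* E :+ V :* D := (P :- Q) :* E :+ V :* D :+ Q :* E) ≈-refl P E V D Q ⟩
        (P - Q) * E + V * D + Q * E   ≈⟨ +-congʳ (+-congʳ ND) ⟨
        N * D + V * D + Q * E         ≈⟨ +-congʳ (distribʳ D N V) ⟨
        (N + V) * D + Q * E           ≈⟨ +-congʳ (*-congʳ n+v≈u) ⟩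
        fromℕᴿ u * D + Q * E          ≈⟨ fromℕ-linear u d q e ⟨
        fromℕᴿ (u ℕ.* d ℕ.+ q ℕ.* e)  ∎))))
      (≈-sym b^n))
    where
    d = suc d-1
    e = suc e-1
    E = fromℕᴿ e
    D = fromℕᴿ d
    P = fromℕᴿ p
    Q = fromℕᴿ q
    V = fromℕᴿ v
    N = fromℤ n
    ND : N * D ≈ (P - Q) * E
    ND = begin-equality
      N * D                      ≈⟨ fromℤ-* n (+ d) ⟨
      fromℤ (n ℤ.* + d)          ≡⟨ cong fromℤ cross ⟩
      fromℤ ((p ℤ.⊖ q) ℤ.* + e)  ≈⟨ fromℤ-* (p ℤ.⊖ q) (+ e) ⟩
      fromℤ (p ℤ.⊖ q) * E        ≈⟨ *-congʳ (fromℤ-⊖ p q) ⟩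
      (P - Q) * E                ∎
    r≤x : fromℚ r ≤ x
    r≤x = *-cancelʳ-≤ (*-positive (fromℕ-positive {e} (s≤s z≤n)) (fromℕ-positive {d} (s≤s z≤n))) (begin
      N * E ⁻¹ * (E * D)     ≈⟨ solve 4 (λ N E′ E D → N :* E′ :* (E :* D) := (E′ :* E) :* (N :* D)) ≈-refl N (E ⁻¹) E D ⟩
      (E ⁻¹ * E) * (N * D)   ≈⟨ *-congʳ (⁻¹-inverseˡ (proj₂ (fromℕ-positive {e} (s≤s z≤n)))) ⟩
      1# * (N * D)           ≈⟨ *-identityˡ _ ⟩
      N * D                  ≈⟨ ND ⟩
      (P - Q) * E            ≤⟨ *-monoˡ-≤ (0≤fromℕ e) (begin
         P - Q          ≤⟨ +-monoˡ-≤ (- Q) p≤xd+q ⟩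
         x * D + Q - Q  ≈⟨ solve 2 (λ x z → x :+ z :- z := x) ≈-refl (x * D) Q ⟩
         x * D          ∎) ⟩
      x * D * E              ≈⟨ solve 3 (λ x D E → x :* D :* E := x :* (E :* D)) ≈-refl x D E ⟩
      x * (E * D)            ∎)

  x*1≈x : ∀ x → x * fromℕᴿ 1 ≈ x
  x*1≈x x = ≈-trans (*-congˡ fromℕ-1) (*-identityʳ x)

  powerSet-0 : ∀ {b} x → 1# ≤ b → PowerSet b x 0#
  powerSet-0 {b} x 1≤b = powerSet⇐ 1≤b ≤-refl 0 0 q
    (begin
      0#                   ≈⟨ -‿inverseʳ x ⟨
      x - x                ≤⟨ +-monoʳ-≤ x (proj₂ (archimedean (- x))) ⟩
      x + fromℕᴿ q         ≈⟨ +-congʳ (x*1≈x x) ⟨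
      x * fromℕᴿ 1 + fromℕᴿ q ∎)
    (begin
      0# ^ 1 * b ^ q       ≈⟨ ≈-trans (*-congʳ (zeroˡ 1#)) (zeroˡ _) ⟩
      0#                   ≤⟨ 0≤1 ⟩
      1#                   ∎)
    where q = proj₁ (archimedean (- x))

  powerSet-bounded : ∀ {b} x → 1# ≤ b → Satisfiable (UpperBound (PowerSet b x))
  powerSet-bounded {b} x 1≤b = b ^ p , λ {y} y∈ → begin
    y               ≈⟨ ≈-trans (*-identityʳ _) (*-identityʳ y) ⟨
    y ^ 1 * b ^ 0   ≤⟨ powerSet⇒ 1≤b y∈ 1 p 0 (begin
      x * fromℕᴿ 1 + 0#  ≈⟨ ≈-trans (+-identityʳ _) (x*1≈x x) ⟩
      x                  ≤⟨ proj₂ (archimedean x) ⟩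
      fromℕᴿ p           ∎) ⟩
    b ^ p           ∎
    where p = proj₁ (archimedean x)

  ^ᴿ-isLUB : ∀ {b} x → 1# ≤ b → IsLUB (PowerSet b x) (b ^ᴿ x)
  ^ᴿ-isLUB {b} x 1≤b = sup-isLUB {PowerSet b x} (0# , powerSet-0 x 1≤b) (powerSet-bounded x 1≤b)

  0≤^ᴿ : ∀ {b} x → 1# ≤ b → 0# ≤ b ^ᴿ x
  0≤^ᴿ x 1≤b = proj₁ (^ᴿ-isLUB x 1≤b) (powerSet-0 x 1≤b)

  ^ᴿ-mono : ∀ {b x x′} → 1# ≤ b → x ≤ x′ → b ^ᴿ x ≤ b ^ᴿ x′
  ^ᴿ-mono 1≤b x≤x′ = proj₂ (^ᴿ-isLUB _ 1≤b) λ { (0≤y , q , q≤x , y≤) →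
    proj₁ (^ᴿ-isLUB _ 1≤b) (0≤y , q , ≤-trans q≤x x≤x′ , y≤) }

  fromℕ-^ : ∀ m n → fromℕᴿ (m ℕ.^ n) ≈ fromℕᴿ m ^ n
  fromℕ-^ m zero    = fromℕ-1
  fromℕ-^ m (suc n) = ≈-trans (fromℕ-* m (m ℕ.^ n)) (*-congˡ (fromℕ-^ m n))

  -- With x ≤ (p − q)/d and (p + 1 − q)/d ≤ x′, the constants are absorbed by
  -- one factor b′.
  ^ᴿ-absorb : ∀ {x x′} → ¬ (x′ ≤ x) → ∀ K C → 1 ℕ.≤ K → 1 ℕ.≤ C →
              ∃[ B ] (∀ b b′ → 1 ℕ.≤ b → 1 ℕ.≤ b′ → B ℕ.≤ b → b ℕ.≤ C ℕ.* b′ → b′ ℕ.≤ C ℕ.* b →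
                fromℕᴿ K * fromℕᴿ b ^ᴿ x ≤ fromℕᴿ b′ ^ᴿ x′)
  ^ᴿ-absorb {x} {x′} x′≰x K C 1≤K 1≤C = case between x′≰x of λ { (p , q , d-1 , x≤ , ≤x′) →
    -- The d-th power of K y contributes K^d; exchanging b and b′ costs C^q in the q-th power and
    -- C^p in the p-th. Their product A is absorbed by the spare factor of b′^(p + 1), which asks
    -- for A ≤ b′; this follows from C A ≤ b ≤ C b′.
    C ℕ.* (K ℕ.^ suc d-1 ℕ.* C ℕ.^ (q ℕ.+ p)) , λ b b′ 1≤b 1≤b′ B≤b b≤ b′≤ →
      lemma p q d-1 x≤ ≤x′ b b′ 1≤b 1≤b′ b≤ b′≤
        (ℕₚ.*-cancelˡ-≤ C {{ℕ.>-nonZero 1≤C}} (ℕₚ.≤-trans B≤b b≤)) }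
    where
    k = fromℕᴿ K
    c = fromℕᴿ C
    0<k = fromℕ-positive 1≤K
    0≤c = 0≤fromℕ C
    lemma : ∀ p q d-1 → x * fromℕᴿ (suc d-1) + fromℕᴿ q ≤ fromℕᴿ p →
            fromℕᴿ (suc p) ≤ x′ * fromℕᴿ (suc d-1) + fromℕᴿ q →
            ∀ b b′ → 1 ℕ.≤ b → 1 ℕ.≤ b′ → b ℕ.≤ C ℕ.* b′ → b′ ℕ.≤ C ℕ.* b →
            K ℕ.^ suc d-1 ℕ.* C ℕ.^ (q ℕ.+ p) ℕ.≤ b′ →
            k * fromℕᴿ b ^ᴿ x ≤ fromℕᴿ b′ ^ᴿ x′
    lemma p q d-1 x≤ ≤x′ b b′ 1≤b 1≤b′ b≤ b′≤ A≤ = begin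
      k * β ^ᴿ x            ≤⟨ *-monoʳ-≤ (proj₁ 0<k) (proj₂ (^ᴿ-isLUB x 1≤β) y≤) ⟩
      k * (k ⁻¹ * β′ ^ᴿ x′) ≈⟨ *-assoc k _ _ ⟨
      k * k ⁻¹ * β′ ^ᴿ x′   ≈⟨ *-congʳ (⁻¹-inverseʳ (proj₂ 0<k)) ⟩
      1# * β′ ^ᴿ x′         ≈⟨ *-identityˡ _ ⟩
      β′ ^ᴿ x′              ∎
      where
      d = suc d-1
      A = K ℕ.^ d ℕ.* C ℕ.^ (q ℕ.+ p)
      β = fromℕᴿ b
      β′ = fromℕᴿ b′
      1≤β = 1≤fromℕ 1≤b
      1≤β′ = 1≤fromℕ 1≤b′
      0≤β = 0≤fromℕ b
      0≤β′ = 0≤fromℕ b′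
      β≤ : β ≤ c * β′
      β≤ = ≤-≈-trans (fromℕ-mono-≤ b≤) (fromℕ-* C b′)
      β′≤ : β′ ≤ c * β
      β′≤ = ≤-≈-trans (fromℕ-mono-≤ b′≤) (fromℕ-* C b)
      a≤ : k ^ d * c ^ (q ℕ.+ p) ≤ β′
      a≤ = begin
        k ^ d * c ^ (q ℕ.+ p)                       ≈⟨ *-cong (fromℕ-^ K d) (fromℕ-^ C (q ℕ.+ p)) ⟨
        fromℕᴿ (K ℕ.^ d) * fromℕᴿ (C ℕ.^ (q ℕ.+ p)) ≈⟨ fromℕ-* (K ℕ.^ d) (C ℕ.^ (q ℕ.+ p)) ⟨
        fromℕᴿ A                                    ≤⟨ fromℕ-mono-≤ A≤ ⟩
        β′                                          ∎
      ky∈ : ∀ {y} → PowerSet β x y → PowerSet β′ x′ (k * y)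
      ky∈ {y} y∈ = powerSet⇐ 1≤β′ (*-nonNeg (proj₁ 0<k) 0≤y) d-1 (suc p) q ≤x′ (begin
        (k * y) ^ d * β′ ^ q                   ≤⟨ *-mono-≤ (0≤^ d (*-nonNeg (proj₁ 0<k) 0≤y)) (0≤^ q 0≤β′) ≤-refl (^-monoˡ-≤ q 0≤β′ β′≤) ⟩
        (k * y) ^ d * (c * β) ^ q              ≈⟨ *-cong (^-distrib-* k y d) (^-distrib-* c β q) ⟩
        (k ^ d * y ^ d) * (c ^ q * β ^ q)      ≈⟨ solve 4 (λ k y c b → (k :* y) :* (c :* b) := (k :* c) :* (y :* b)) ≈-refl (k ^ d) (y ^ d) (c ^ q) (β ^ q) ⟩
        (k ^ d * c ^ q) * (y ^ d * β ^ q)      ≤⟨ *-monoʳ-≤ 0≤kc (≤-trans (powerSet⇒ 1≤β y∈ d p q x≤) (^-monoˡ-≤ p 0≤β β≤)) ⟩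
        (k ^ d * c ^ q) * (c * β′) ^ p         ≈⟨ *-congˡ (^-distrib-* c β′ p) ⟩
        (k ^ d * c ^ q) * (c ^ p * β′ ^ p)     ≈⟨ solve 4 (λ k c c′ b → (k :* c) :* (c′ :* b) := (k :* (c :* c′)) :* b) ≈-refl (k ^ d) (c ^ q) (c ^ p) (β′ ^ p) ⟩
        (k ^ d * (c ^ q * c ^ p)) * β′ ^ p     ≈⟨ *-congʳ (*-congˡ (^-homo-* c q p)) ⟨
        (k ^ d * c ^ (q ℕ.+ p)) * β′ ^ p       ≤⟨ *-monoˡ-≤ (0≤^ p 0≤β′) a≤ ⟩
        β′ * β′ ^ p                            ∎)
        where
        0≤y = proj₁ y∈
        0≤kc = *-nonNeg (0≤^ d (proj₁ 0<k)) (0≤^ q 0≤c)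
      y≤ : UpperBound (PowerSet β x) (k ⁻¹ * β′ ^ᴿ x′)
      y≤ {y} y∈ = *-cancelʳ-≤ 0<k (begin
        y * k                    ≈⟨ *-comm y k ⟩
        k * y                    ≤⟨ proj₁ (^ᴿ-isLUB x′ 1≤β′) (ky∈ y∈) ⟩
        β′ ^ᴿ x′                 ≈⟨ *-identityˡ _ ⟨
        1# * β′ ^ᴿ x′            ≈⟨ *-congʳ (⁻¹-inverseʳ (proj₂ 0<k)) ⟨
        k * k ⁻¹ * β′ ^ᴿ x′      ≈⟨ solve 3 (λ k l z → k :* l :* z := l :* z :* k) ≈-refl k (k ⁻¹) (β′ ^ᴿ x′) ⟩
        k ⁻¹ * β′ ^ᴿ x′ * k      ∎)

  -- Evaluation at real points

  eval-cong : ∀ {m} (P : Vec ℤ m) {x y} → x ≈ y → eval P x ≈ eval P y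
  eval-cong []       x≈y = ≈-refl
  eval-cong (c ∷ cs) x≈y = +-congˡ (*-cong x≈y (eval-cong cs x≈y))

  eval-fromℤ : ∀ {m} (P : Vec ℤ m) r → eval P (fromℤ r) ≈ fromℤ (evalℤ P r)
  eval-fromℤ []       r = ≈-refl
  eval-fromℤ (c ∷ cs) r = begin-equality
    fromℤ c + fromℤ r * eval cs (fromℤ r)       ≈⟨ +-congˡ (*-congˡ (eval-fromℤ cs r)) ⟩
    fromℤ c + fromℤ r * fromℤ (evalℤ cs r)      ≈⟨ +-congˡ (fromℤ-* r (evalℤ cs r)) ⟨
    fromℤ c + fromℤ (r ℤ.* evalℤ cs r)          ≈⟨ fromℤ-+ c (r ℤ.* evalℤ cs r) ⟨
    fromℤ (c ℤ.+ r ℤ.* evalℤ cs r)              ∎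

  eval-quot : ∀ {m} r x (P : Vec ℤ (suc m)) →
              eval P x ≈ fromℤ (evalℤ P r) + (x - fromℤ r) * eval (quot r P) x
  eval-quot r x (c ∷ []) = begin-equality
    C + x * 0#                        ≈⟨ solve 3 (λ C R x → C :+ x :* con ℤ.0ℤ := C :+ R :* con ℤ.0ℤ :+ (x :- R) :* con ℤ.0ℤ) ≈-refl C R x ⟩
    C + R * 0# + (x - R) * 0#         ≈⟨ +-congʳ (≈-trans (fromℤ-+ c (r ℤ.* ℤ.0ℤ)) (+-congˡ (fromℤ-* r ℤ.0ℤ))) ⟨
    fromℤ (c ℤ.+ r ℤ.* ℤ.0ℤ) + (x - R) * 0# ∎
    where
    C = fromℤ c
    R = fromℤ r
  eval-quot r x (c ∷ cs@(_ ∷ _)) = begin-equality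
    C + x * eval cs x                        ≈⟨ +-congˡ (*-congˡ (eval-quot r x cs)) ⟩
    C + x * (e + (x - R) * q)                ≈⟨ solve 5 (λ C R x e q → C :+ x :* (e :+ (x :- R) :* q) := C :+ R :* e :+ (x :- R) :* (e :+ x :* q)) ≈-refl C R x e q ⟩
    C + R * e + (x - R) * (e + x * q)        ≈⟨ +-congʳ (≈-trans (fromℤ-+ c (r ℤ.* evalℤ cs r)) (+-congˡ (fromℤ-* r (evalℤ cs r)))) ⟨
    fromℤ (c ℤ.+ r ℤ.* evalℤ cs r) + (x - R) * (e + x * q) ∎
    where
    C = fromℤ c
    R = fromℤ r
    e = fromℤ (evalℤ cs r)
    q = eval (quot r cs) x

  eval-shift : ∀ {m} r x (P : Vec ℤ m) → eval (shift r P) (x - fromℤ r) ≈ eval P x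
  eval-shift {zero}  r x [] = ≈-refl
  eval-shift {suc m} r x P  = ≈-trans (+-congˡ (*-congˡ (eval-shift r x (quot r P)))) (≈-sym (eval-quot r x P))

  eval-∷ʳ : ∀ {m} (P : Vec ℤ m) c x → eval (P ∷ʳ c) x ≈ eval P x + fromℤ c * x ^ m
  eval-∷ʳ [] c x = begin-equality
    fromℤ c + x * 0#    ≈⟨ ≈-trans (+-congˡ (zeroʳ x)) (+-comm _ _) ⟩
    0# + fromℤ c        ≈⟨ +-congˡ (*-identityʳ _) ⟨
    0# + fromℤ c * 1#   ∎
  eval-∷ʳ {suc m} (d ∷ P) c x = begin-equality
    fromℤ d + x * eval (P ∷ʳ c) x                   ≈⟨ +-congˡ (*-congˡ (eval-∷ʳ P c x)) ⟩
    fromℤ d + x * (eval P x + fromℤ c * x ^ m)      ≈⟨ solve 5 (λ d x e c y → d :+ x :* (e :+ c :* y) := d :+ x :* e :+ c :* (x :* y)) ≈-refl (fromℤ d) x (eval P x) (fromℤ c) (x ^ m) ⟩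
    fromℤ d + x * eval P x + fromℤ c * (x * x ^ m)  ∎

  -- As t is the inverse of M y, the factor t (M y)^m is (M y)^(m - 1), written so that it also
  -- makes sense for m = 0.
  eval-revScale : ∀ {M t y m} → t * (fromℕᴿ M * y) ≈ 1# → (P : Vec ℤ m) →
                  eval (revScale M P) y ≈ (t * (fromℕᴿ M * y) ^ m) * eval P t
  eval-revScale                    inv [] = ≈-sym (zeroʳ _)
  eval-revScale {M} {t} {y} {suc m} inv (c ∷ cs) = begin-equality
    eval (revScale M cs ∷ʳ (c ℤ.* + (M ℕ.^ m))) y             ≈⟨ eval-∷ʳ (revScale M cs) (c ℤ.* + (M ℕ.^ m)) y ⟩
    eval (revScale M cs) y + fromℤ (c ℤ.* + (M ℕ.^ m)) * y ^ m ≈⟨ +-cong (eval-revScale inv cs) lead ⟩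
    (t * s ^ m) * e + C * s ^ m                              ≈⟨ *-identityˡ _ ⟨
    1# * ((t * s ^ m) * e + C * s ^ m)                       ≈⟨ *-congʳ inv ⟨
    (t * s) * ((t * s ^ m) * e + C * s ^ m)                  ≈⟨ solve 5 (λ t s z e C → (t :* s) :* ((t :* z) :* e :+ C :* z) := (t :* (s :* z)) :* (C :+ t :* e)) ≈-refl t s (s ^ m) e C ⟩
    (t * (s * s ^ m)) * (C + t * e)                          ∎
    where
    s = fromℕᴿ M * y
    e = eval cs t
    C = fromℤ c
    lead : fromℤ (c ℤ.* + (M ℕ.^ m)) * y ^ m ≈ C * s ^ m
    lead = begin-equality
      fromℤ (c ℤ.* + (M ℕ.^ m)) * y ^ m    ≈⟨ *-congʳ (fromℤ-* c (+ (M ℕ.^ m))) ⟩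
      C * fromℕᴿ (M ℕ.^ m) * y ^ m         ≈⟨ *-congʳ (*-congˡ (fromℕ-^ M m)) ⟩
      C * fromℕᴿ M ^ m * y ^ m             ≈⟨ *-assoc C _ _ ⟩
      C * (fromℕᴿ M ^ m * y ^ m)           ≈⟨ *-congˡ (^-distrib-* (fromℕᴿ M) y m) ⟨
      C * s ^ m                            ∎

  eval-0ᵖ : ∀ m x → eval (replicate m ℤ.0ℤ) x ≈ 0#
  eval-0ᵖ zero    x = ≈-refl
  eval-0ᵖ (suc m) x = ≈-trans (+-identityˡ _) (≈-trans (*-congˡ (eval-0ᵖ m x)) (zeroʳ x))

  fromℤ≈0⇒∣∣≡0 : ∀ a → fromℤ a ≈ 0# → ℤ.∣ a ∣ ≡ 0
  fromℤ≈0⇒∣∣≡0 (+ n)    eq = ℕₚ.n≤0⇒n≡0 (fromℕ-cancel-≤ (≤-reflexive eq))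
  fromℤ≈0⇒∣∣≡0 -[1+ n ] eq = ℕₚ.n≤0⇒n≡0 (fromℕ-cancel-≤ (≤-reflexive (begin-equality
    fromℕᴿ (suc n)      ≈⟨ Ringₚ.-‿involutive _ ⟨
    - - fromℕᴿ (suc n)  ≈⟨ -‿cong eq ⟩
    - 0#                ≈⟨ Ringₚ.-0#≈0# ⟩
    0#                  ∎)))

  ∣∣-lub : ∀ {x b} → x ≤ b → - x ≤ b → ∣ x ∣ ≤ b
  ∣∣-lub = Max.⊔-lub

  ∣0∣≤ : ∀ {x b} → x ≈ 0# → 0# ≤ b → ∣ x ∣ ≤ b
  ∣0∣≤ x≈0 0≤b = ∣∣-lub (≈-≤-trans x≈0 0≤b) (≈-≤-trans (≈-trans (-‿cong x≈0) Ringₚ.-0#≈0#) 0≤b)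

  -- The real factor is rounded up to a natural number K ≥ 1, the form of constant that `^ᴿ-absorb`
  -- takes.
  ∣∣-scale : ∀ κ → ∃[ K ] (1 ℕ.≤ K × (∀ {x y b} → y ≈ κ * x → ∣ x ∣ ≤ b → ∣ y ∣ ≤ fromℕᴿ K * b))
  ∣∣-scale κ = K , s≤s z≤n , bound
    where
    k₁ k₂ K : ℕ
    k₁ = proj₁ (archimedean κ)
    k₂ = proj₁ (archimedean (- κ))
    K = suc (k₁ ℕ.⊔ k₂)
    κ≤K : κ ≤ fromℕᴿ K
    κ≤K = ≤-trans (proj₂ (archimedean κ))
      (fromℕ-mono-≤ {k₁} {K} (ℕₚ.m≤n⇒m≤1+n (ℕₚ.m≤m⊔n k₁ k₂)))
    -κ≤K : - κ ≤ fromℕᴿ K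
    -κ≤K = ≤-trans (proj₂ (archimedean (- κ)))
      (fromℕ-mono-≤ {k₂} {K} (ℕₚ.m≤n⇒m≤1+n (ℕₚ.m≤n⊔m k₁ k₂)))
    0≤bound : ∀ {x b} → x ≤ b → - x ≤ b → 0# ≤ b
    0≤bound {x} x≤b -x≤b with ≤-total 0# x
    ... | inj₁ 0≤x = ≤-trans 0≤x x≤b
    ... | inj₂ x≤0 = ≤-trans (≤0⇒0≤- x≤0) -x≤b
    half : ∀ {x b} → x ≤ b → - x ≤ b → κ * x ≤ fromℕᴿ K * b
    half {x} {b} x≤b -x≤b with ≤-total 0# κ
    ... | inj₁ 0≤κ = ≤-trans (*-monoʳ-≤ 0≤κ x≤b) (*-monoˡ-≤ (0≤bound x≤b -x≤b) κ≤K)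
    ... | inj₂ κ≤0 = begin
      κ * x          ≈⟨ solve 2 (λ k x → k :* x := (:- k) :* (:- x)) ≈-refl κ x ⟩
      - κ * - x      ≤⟨ *-monoʳ-≤ (≤0⇒0≤- κ≤0) -x≤b ⟩
      - κ * b        ≤⟨ *-monoˡ-≤ (0≤bound x≤b -x≤b) -κ≤K ⟩
      fromℕᴿ K * b   ∎
    bound : ∀ {x y b} → y ≈ κ * x → ∣ x ∣ ≤ b → ∣ y ∣ ≤ fromℕᴿ K * b
    bound {x} {y} {b} y≈κx ∣x∣≤b = ∣∣-lub
      (≈-≤-trans y≈κx (half x≤b -x≤b))
      (≈-≤-trans (≈-trans (-‿cong y≈κx) (Ringₚ.-‿distribʳ-* κ x))
        (half -x≤b (≈-≤-trans (Ringₚ.-‿involutive x) x≤b)))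
      where
      x≤b = ≤-trans (Max.x≤x⊔y x (- x)) ∣x∣≤b
      -x≤b = ≤-trans (Max.x≤y⊔x x (- x)) ∣x∣≤b

  -- Exponents

  -- Polynomials of norm below B lie in a box, which has finitely many elements.
  infinite⇒unbounded : ∀ {k} {S : Pred (Poly k) 0ℓ} → Infinite S → Unbounded S
  infinite⇒unbounded {k} {S} inf B with lem {∃[ P ] (S P × B ℕ.≤ ‖ P ‖)}
  ... | yes p = p
  ... | no ¬p = contradiction (box (suc k) B , λ {P} SP →
    ∈-box P (ℕₚ.<⇒≤ (ℕₚ.≰⇒> λ B≤ → ¬p (P , SP , B≤)))) inf

  approx-antitone : ∀ {k ξ w w′ P} → w ≤ w′ → Approx k ξ w′ P → Approx k ξ w P
  approx-antitone {P = P} w≤w′ (P≢0 , ap) =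
    P≢0 , ≤-trans ap (^ᴿ-mono (1≤fromℕ (≢0ᵖ⇒1≤‖‖ P P≢0)) (neg-mono-≤ w≤w′))

  -- One statement for both directions between ξ and ξᵢ. The sets `S` and `S′` carry further
  -- properties along: largeness at rᵢ is turned into a dominant leading coefficient. Norm bounds in
  -- both directions are needed because the exponents may have either sign.
  transfer : ∀ {k ξ η} (Φ : Poly k → Poly k) C₁ C₂ → 1 ℕ.≤ C₁ → 1 ℕ.≤ C₂ →
             (∀ P → ‖ Φ P ‖ ℕ.≤ C₁ ℕ.* ‖ P ‖) → (∀ P → ‖ P ‖ ℕ.≤ C₂ ℕ.* ‖ Φ P ‖) →
             ∀ κ → (∀ P → eval (Φ P) η ≈ κ * eval P ξ) →
             ∀ {w w′} → ¬ (w ≤ w′) → ∀ {S S′ : Pred (Poly k) 0ℓ} →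
             (∀ {P} → S P → Approx k ξ w P) → (∀ {P} → S P → Approx k η w′ (Φ P) → S′ (Φ P)) →
             Unbounded S → Unbounded S′
  transfer {k} {ξ} {η} Φ C₁ C₂ 1≤C₁ 1≤C₂ ΦP≤ P≤ κ evalΦ {w} {w′} w≰w′ {S} {S′} S⊆ S⇒S′ unb with ∣∣-scale κ
  ... | K , 1≤K , scale = λ B₀ → case ^ᴿ-absorb -w′≰-w K (C₁ ℕ.* C₂) 1≤K (ℕₚ.*-mono-≤ 1≤C₁ 1≤C₂) of
    -- Norm at least `B` lets the constants be absorbed; norm at least `C₂ * suc B₀` makes the image
    -- larger than `B₀`, hence non-zero even for `B₀ = 0`.
    λ { (B , absorb) → case unb (B ℕ.⊔ C₂ ℕ.* suc B₀) of λ { (P , SP , ≤‖P‖) →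
      image B₀ P SP (ℕₚ.≤-trans (ℕₚ.m≤n⊔m B _) ≤‖P‖)
        (λ 1≤P 1≤ΦP → absorb ‖ P ‖ ‖ Φ P ‖ 1≤P 1≤ΦP (ℕₚ.≤-trans (ℕₚ.m≤m⊔n B _) ≤‖P‖)
          (ℕₚ.≤-trans (P≤ P) (ℕₚ.*-monoˡ-≤ ‖ Φ P ‖ (ℕₚ.m≤n*m C₂ C₁ {{ℕ.>-nonZero 1≤C₁}})))
          (ℕₚ.≤-trans (ΦP≤ P) (ℕₚ.*-monoˡ-≤ ‖ P ‖ (ℕₚ.m≤m*n C₁ C₂ {{ℕ.>-nonZero 1≤C₂}})))) } }
    where
    -w′≰-w : ¬ (- w′ ≤ - w)
    -w′≰-w p = w≰w′ (begin
      w      ≈⟨ Ringₚ.-‿involutive w ⟨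
      - - w  ≤⟨ neg-mono-≤ p ⟩
      - - w′ ≈⟨ Ringₚ.-‿involutive w′ ⟩
      w′     ∎)
    image : ∀ B₀ P → S P → C₂ ℕ.* suc B₀ ℕ.≤ ‖ P ‖ →
            (1 ℕ.≤ ‖ P ‖ → 1 ℕ.≤ ‖ Φ P ‖ →
             fromℕᴿ K * fromℕᴿ ‖ P ‖ ^ᴿ (- w) ≤ fromℕᴿ ‖ Φ P ‖ ^ᴿ (- w′)) →
            ∃[ Q ] (S′ Q × B₀ ℕ.≤ ‖ Q ‖)
    image B₀ P SP ≤‖P‖ absorb = Φ P ,
      S⇒S′ SP (1≤‖‖⇒≢0ᵖ (Φ P) 1≤ΦP ,
        ≤-trans (scale (evalΦ P) (proj₂ (S⊆ SP))) (absorb (≢0ᵖ⇒1≤‖‖ P (proj₁ (S⊆ SP))) 1≤ΦP)) ,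
      ℕₚ.<⇒≤ B₀<
      where
      B₀< : suc B₀ ℕ.≤ ‖ Φ P ‖
      B₀< = ℕₚ.*-cancelˡ-≤ C₂ {{ℕ.>-nonZero 1≤C₂}} (ℕₚ.≤-trans ≤‖P‖ (P≤ P))
      1≤ΦP = ℕₚ.≤-trans (s≤s z≤n) B₀<

  -- Suppose that each index i fails, at some exponent wᵢ and beyond some norm Bᵢ. Take a polynomial
  -- in the family at the largest wᵢ whose norm is at least all Bᵢ. It belongs to some `T i`, and by
  -- antitonicity to the family at wᵢ, against the choice of Bᵢ.
  pigeonhole : ∀ {k n} (F : Carrier → Pred (Poly k) 0ℓ) → (∀ {w w′ P} → w ≤ w′ → F w′ P → F w P) →
               (T : Fin (suc n) → Pred (Poly k) 0ℓ) → (∀ P → ∃[ i ] T i P) →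
               ∃[ i ] (∀ w → Unbounded (F w) → Unbounded (λ P → F w P × T i P))
  pigeonhole F antitone T cover with lem {∃[ i ] (∀ w → Unbounded (F w) → Unbounded (λ P → F w P × T i P))}
  ... | yes p = p
  ... | no ¬p = contradiction (proj₁ (proj₂ (bad (proj₁ wₘ))) (proj₁ (bound (proj₁ Bₘ))))
    λ { (P , FP , B≤) → case cover P of λ { (i , TP) →
        proj₂ (bound i) P (antitone (proj₂ wₘ i) FP) TP (ℕₚ.≤-trans (proj₂ Bₘ i) B≤) } }
    where
    Bad : _ → Set
    Bad i = ∃[ w ] (Unbounded (F w) × ∃[ B ] (∀ P → F w P → T i P → ¬ (B ℕ.≤ ‖ P ‖)))
    bad : ∀ i → Bad i
    bad i with lem {Bad i}
    ... | yes b = b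
    ... | no ¬b = contradiction (i , good) ¬p
      where
      good : ∀ w → Unbounded (F w) → Unbounded (λ P → F w P × T i P)
      good w unb B with lem {∃[ P ] ((F w P × T i P) × B ℕ.≤ ‖ P ‖)}
      ... | yes q = q
      ... | no ¬q = contradiction (w , unb , B , λ P FP TP B≤ → ¬q (P , (FP , TP) , B≤)) ¬b
    bound = λ i → proj₂ (proj₂ (bad i))
    wₘ = maximum totalOrder (λ i → proj₁ (bad i))
    Bₘ = maximum ℕₚ.≤-totalOrder (λ i → proj₁ (bound i))

  -- The multiples N (x - r) with N = B + 1 are witnesses; they have degree 1, hence `1 ≤ k`.
  roots-unbounded : ∀ {k ξ} → 1 ℕ.≤ k → ∀ r → fromℤ r ≈ ξ →
                    Unbounded (λ (P : Poly k) → P ≢ 0ᵖ × eval P ξ ≈ 0#)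
  roots-unbounded {suc k} {ξ} _ r r≈ξ B = P , (1≤‖‖⇒≢0ᵖ P (ℕₚ.≤-trans (s≤s z≤n) B<) , root) , ℕₚ.<⇒≤ B<
    where
    N = + suc B
    c = ℤ.- (N ℤ.* r)
    P : Poly (suc k)
    P = c ∷ N ∷ replicate k ℤ.0ℤ
    B< : suc B ℕ.≤ ‖ P ‖
    B< = ℕₚ.≤-trans (∣head∣≤‖‖ N (replicate k ℤ.0ℤ)) (‖tail‖≤‖‖ c (N ∷ replicate k ℤ.0ℤ))
    root : eval P ξ ≈ 0#
    root = begin-equality
      fromℤ c + ξ * (fromℤ N + ξ * eval (replicate k ℤ.0ℤ) ξ)
        ≈⟨ +-cong (≈-trans (fromℤ-neg (N ℤ.* r)) (-‿cong (≈-trans (fromℤ-* N r) (*-congˡ r≈ξ))))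
                  (*-congˡ (+-congˡ (*-congˡ (eval-0ᵖ k ξ)))) ⟩
      - (fromℤ N * ξ) + ξ * (fromℤ N + ξ * 0#)
        ≈⟨ solve 2 (λ N x → :- (N :* x) :+ x :* (N :+ x :* con ℤ.0ℤ) := con ℤ.0ℤ) ≈-refl (fromℤ N) ξ ⟩
      0# ∎

  -- The scale M, the index i and the comparison of exponents

  module _ (k : ℕ) (1≤k : 1 ℕ.≤ k) (r : Fin (suc k) → ℤ) (inj : Injective _≡_ _≡_ r)
           {ρ : ℕ} (r≤ρ : ∀ i → ℤ.∣ r i ∣ ℕ.≤ ρ) where
    private
      -- S bounds the growth of the norm under a shift and I is the interpolation constant, so ‖P(x
      -- + rᵢ)‖ ≤ S ‖P‖ ≤ S I |P(rᵢ)| for P large at rᵢ. With M = S I this is the condition of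
      -- `leadCoeff-revScale`.
      S I M : ℕ
      S = shiftBound ρ (suc k)
      I = (suc ρ ℕ.* 2) ℕ.^ suc k
      M = S ℕ.* I

      1≤M : 1 ℕ.≤ M
      1≤M = ℕₚ.*-mono-≤ (1≤shiftBound ρ (suc k)) (ℕₚ.m^n>0 (suc ρ ℕ.* 2) (suc k))

      Large : Fin (suc k) → Pred (Poly k) 0ℓ
      Large i P = ‖ P ‖ ℕ.≤ I ℕ.* ℤ.∣ evalℤ P (r i) ∣

      Suitable : Carrier → Fin (suc k) → Set
      Suitable ξ i = ¬ (fromℤ (r i) ≈ ξ) ×
        (∀ w → Unbounded (Approx k ξ w) → Unbounded (λ P → Approx k ξ w P × Large i P))

      -- If ξ = rⱼ, the family of polynomials vanishing at ξ is unbounded, and largeness at a point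
      -- rᵢ = ξ would give ‖P‖ ≤ I · 0 for a member of norm at least 1. The vanishing polynomials
      -- then serve as approximations for every w.
      suitable : ∀ ξ → ∃[ i ] Suitable ξ i
      suitable ξ with lem {∃[ j ] (fromℤ (r j) ≈ ξ)}
      ... | no  none = case pigeonhole (Approx k ξ) approx-antitone Large (interpolation-index k r inj r≤ρ) of
        λ { (i , unb) → i , (λ rᵢ≈ξ → none (i , rᵢ≈ξ)) , unb }
      ... | yes (j , rⱼ≈ξ) = case pigeonhole (λ _ → Vanishing) (λ _ FP → FP) Large (interpolation-index k r inj r≤ρ) of
        -- The family is constant in w, so `0#` stands for an arbitrary exponent.
        λ { (i , unb) → i , rᵢ≉ξ i (unb 0# (roots-unbounded 1≤k (r j) rⱼ≈ξ)) ,
            λ w _ B → case unb 0# (roots-unbounded 1≤k (r j) rⱼ≈ξ) B of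
              λ { (P , ((P≢0 , P[ξ]≈0) , PL) , B≤) →
                P , ((P≢0 , ∣0∣≤ P[ξ]≈0 (0≤^ᴿ _ (1≤fromℕ (≢0ᵖ⇒1≤‖‖ P P≢0)))) , PL) , B≤ } }
        where
        Vanishing : Pred (Poly k) 0ℓ
        Vanishing P = P ≢ 0ᵖ × eval P ξ ≈ 0#
        rᵢ≉ξ : ∀ i → Unbounded (λ P → Vanishing P × Large i P) → ¬ (fromℤ (r i) ≈ ξ)
        rᵢ≉ξ i unb rᵢ≈ξ with unb 1
        ... | P , ((_ , P[ξ]≈0) , PL) , 1≤P = ℕₚ.<⇒≱ 1≤P (ℕₚ.≤-trans PL (ℕₚ.≤-reflexive
          (trans (cong (I ℕ.*_) (fromℤ≈0⇒∣∣≡0 (evalℤ P (r i)) (≈-trans (≈-sym (eval-fromℤ P (r i)))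
            (≈-trans (eval-cong P rᵢ≈ξ) P[ξ]≈0)))) (ℕₚ.*-zeroʳ I))))

      module _ {ξ : Carrier} {i : Fin (suc k)} (rᵢ≉ξ : ¬ (fromℤ (r i) ≈ ξ))
               (unb : ∀ w → Unbounded (Approx k ξ w) → Unbounded (λ P → Approx k ξ w P × Large i P)) where
        t η : Carrier
        t = ξ - fromℤ (r i)
        η = (fromℕᴿ M * t) ⁻¹

        Mtη≈1 : fromℕᴿ M * t * η ≈ 1#
        Mtη≈1 = ⁻¹-inverseʳ (*-≉0 (proj₂ (fromℕ-positive 1≤M)) λ t≈0 → rᵢ≉ξ (begin-equality
          fromℤ (r i)       ≈⟨ +-identityˡ _ ⟨
          0# + fromℤ (r i)  ≈⟨ +-congʳ t≈0 ⟨
          t + fromℤ (r i)   ≈⟨ solve 2 (λ x z → x :- z :+ z := x) ≈-refl ξ (fromℤ (r i)) ⟩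
          ξ                 ∎))

        tMη≈1 : t * (fromℕᴿ M * η) ≈ 1#
        tMη≈1 = ≈-trans (solve 3 (λ m t e → t :* (m :* e) := m :* t :* e) ≈-refl (fromℕᴿ M) t η) Mtη≈1

        ηMt≈1 : η * (fromℕᴿ M * t) ≈ 1#
        ηMt≈1 = ≈-trans (*-comm _ _) Mtη≈1

        -- Ψ Q is (M (x - rᵢ))^k Q(1/(M (x - rᵢ))), and Ψ (Φ P) = M^k P: up to a constant, Ψ undoes
        -- the substitution in Φ.
        Φ Ψ : Poly k → Poly k
        Φ P = revScale M (shift (r i) P)
        Ψ Q = shift (ℤ.- r i) (revScale M Q)

        -r≤ρ : ℤ.∣ ℤ.- r i ∣ ℕ.≤ ρ
        -r≤ρ = subst (ℕ._≤ ρ) (sym (ℤₚ.∣-i∣≡∣i∣ (r i))) (r≤ρ i)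

        R Mᵏ : ℕ
        R = suc ρ ℕ.^ suc k
        Mᵏ = M ℕ.^ suc k

        1≤Mᵏ : 1 ℕ.≤ Mᵏ
        1≤Mᵏ = ℕₚ.m^n>0 M {{ℕ.>-nonZero 1≤M}} (suc k)

        1≤R : 1 ℕ.≤ R
        1≤R = 1≤^ ρ (suc k)

        1≤S : 1 ℕ.≤ S
        1≤S = 1≤shiftBound ρ (suc k)

        Φ-upper : ∀ P → ‖ Φ P ‖ ℕ.≤ Mᵏ ℕ.* S ℕ.* ‖ P ‖
        Φ-upper P = ℕₚ.≤-trans (‖revScale‖≤ 1≤M (shift (r i) P))
          (ℕₚ.≤-trans (ℕₚ.*-monoʳ-≤ Mᵏ (‖shift‖≤ (r≤ρ i) P)) (ℕₚ.≤-reflexive (sym (ℕₚ.*-assoc Mᵏ S ‖ P ‖))))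

        Φ-lower : ∀ P → ‖ P ‖ ℕ.≤ R ℕ.* ‖ Φ P ‖
        Φ-lower P = ℕₚ.≤-trans (‖‖≤shift (r≤ρ i) P) (ℕₚ.*-monoʳ-≤ R (‖‖≤revScale 1≤M (shift (r i) P)))

        Ψ-upper : ∀ Q → ‖ Ψ Q ‖ ℕ.≤ S ℕ.* Mᵏ ℕ.* ‖ Q ‖
        Ψ-upper Q = ℕₚ.≤-trans (‖shift‖≤ -r≤ρ (revScale M Q))
          (ℕₚ.≤-trans (ℕₚ.*-monoʳ-≤ S (‖revScale‖≤ 1≤M Q)) (ℕₚ.≤-reflexive (sym (ℕₚ.*-assoc S Mᵏ ‖ Q ‖))))

        Ψ-lower : ∀ Q → ‖ Q ‖ ℕ.≤ R ℕ.* ‖ Ψ Q ‖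
        Ψ-lower Q = ℕₚ.≤-trans (‖‖≤revScale 1≤M Q) (‖‖≤shift -r≤ρ (revScale M Q))

        eval-Φ : ∀ P → eval (Φ P) η ≈ (t * (fromℕᴿ M * η) ^ suc k) * eval P ξ
        eval-Φ P = ≈-trans (eval-revScale tMη≈1 (shift (r i) P)) (*-congˡ (eval-shift (r i) ξ P))

        eval-Ψ : ∀ Q → eval (Ψ Q) ξ ≈ (η * (fromℕᴿ M * t) ^ suc k) * eval Q η
        eval-Ψ Q = begin-equality
          eval (Ψ Q) ξ                          ≈⟨ eval-cong (Ψ Q) t-r≈ξ ⟨
          eval (Ψ Q) (t - fromℤ (ℤ.- r i))      ≈⟨ eval-shift (ℤ.- r i) t (revScale M Q) ⟩
          eval (revScale M Q) t                 ≈⟨ eval-revScale ηMt≈1 Q ⟩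
          (η * (fromℕᴿ M * t) ^ suc k) * eval Q η ∎
          where
          t-r≈ξ : t - fromℤ (ℤ.- r i) ≈ ξ
          t-r≈ξ = ≈-trans (+-congˡ (-‿cong (fromℤ-neg (r i))))
            (solve 2 (λ x z → x :- z :- :- z := x) ≈-refl ξ (fromℤ (r i)))

        Φ-lead : ∀ P → Large i P → ℤ.∣ leadCoeff k (Φ P) ∣ ≡ ‖ Φ P ‖
        Φ-lead P PL = leadCoeff-revScale 1≤M k (shift (r i) P) (evalℤ P (r i)) _ refl
          (ℕₚ.≤-trans (‖shift‖≤ (r≤ρ i) P) (ℕₚ.≤-trans (ℕₚ.*-monoʳ-≤ S PL)
            (ℕₚ.≤-reflexive (sym (ℕₚ.*-assoc S I ℤ.∣ evalℤ P (r i) ∣)))))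

        Ξ H Hˡᵉᵃᵈ : Pred Carrier 0ℓ
        Ξ w = Infinite (Approx k ξ w)
        H w = Infinite (Approx k η w)
        Hˡᵉᵃᵈ w = Infinite λ P → Approx k η w P × ℤ.∣ leadCoeff k P ∣ ≡ ‖ P ‖

        Ξ⊑Hˡᵉᵃᵈ : Ξ ⊑ Hˡᵉᵃᵈ
        Ξ⊑Hˡᵉᵃᵈ {w} inf w≰w′ = unbounded⇒infinite (transfer Φ (Mᵏ ℕ.* S) R
          (ℕₚ.*-mono-≤ 1≤Mᵏ 1≤S) 1≤R Φ-upper Φ-lower _ eval-Φ w≰w′
          proj₁ (λ { {P} (_ , PL) ap → ap , Φ-lead P PL }) (unb w (infinite⇒unbounded inf)))

        H⊑Ξ : H ⊑ Ξ
        H⊑Ξ inf w≰w′ = unbounded⇒infinite (transfer Ψ (S ℕ.* Mᵏ) R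
          (ℕₚ.*-mono-≤ 1≤S 1≤Mᵏ) 1≤R Ψ-upper Ψ-lower _ eval-Ψ w≰w′
          (λ ap → ap) (λ _ ap → ap) (infinite⇒unbounded inf))

        Hˡᵉᵃᵈ⊆H : ∀ {w} → Hˡᵉᵃᵈ w → H w
        Hˡᵉᵃᵈ⊆H inf (Ps , H⊆) = inf (Ps , λ { (ap , _) → H⊆ ap })

        -- The detour through ξ replaces arbitrary approximations of η by ones with dominant leading
        -- coefficient, since the index i was chosen for approximations of ξ.
        H⊑Hˡᵉᵃᵈ : H ⊑ Hˡᵉᵃᵈ
        H⊑Hˡᵉᵃᵈ = ⊑-trans {H} {Ξ} {Hˡᵉᵃᵈ} H⊑Ξ Ξ⊑Hˡᵉᵃᵈ

        -- The inclusion keeps w, whereas `_⊑_` asks for a smaller w′; `H⊑Hˡᵉᵃᵈ` supplies the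
        -- descent.
        Hˡᵉᵃᵈ⊑H : Hˡᵉᵃᵈ ⊑ H
        Hˡᵉᵃᵈ⊑H inf w≰w′ = Hˡᵉᵃᵈ⊆H (H⊑Hˡᵉᵃᵈ (Hˡᵉᵃᵈ⊆H inf) w≰w′)

        exponents : (ωˡᵉᵃᵈ k η ≈± ω k η) × (ω k η ≈± ω k ξ)
        exponents = sup-cong {Hˡᵉᵃᵈ} {H} Hˡᵉᵃᵈ⊑H H⊑Hˡᵉᵃᵈ ,
          sup-cong {H} {Ξ} H⊑Ξ (λ inf w≰w′ → Hˡᵉᵃᵈ⊆H (Ξ⊑Hˡᵉᵃᵈ inf w≰w′))

    possible-scale : ∃[ M ] (1 ℕ.≤ M × ((ξ : Carrier) →
      ∃[ i ] (¬ (fromℤ (r i) ≈ ξ) ×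
        (let ξᵢ = (fromℕᴿ M * (ξ - fromℤ (r i))) ⁻¹ in
          (ωˡᵉᵃᵈ k ξᵢ ≈± ω k ξᵢ) × (ω k ξᵢ ≈± ω k ξ)))))
    possible-scale = M , 1≤M , λ ξ → case suitable ξ of
      λ { (i , rᵢ≉ξ , unb) → i , rᵢ≉ξ , exponents rᵢ≉ξ unb }

mainTheorem1 :
  (lem : ExcludedMiddle 0ℓ) (ℝ : CompleteOrderedField) →
  let open CompleteOrderedField ℝ
      open Exponents lem ℝ
  in
  (k : ℕ) → 1 ℕ.≤ k →
  (r : Fin (ℕ.suc k) → ℤ) → Injective _≡_ _≡_ r →
  ∃[ M ] (1 ℕ.≤ M × ((ξ : Carrier) →
    ∃[ i ] (¬ (fromℤ (r i) ≈ ξ) ×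
      (let ξᵢ = (fromℕᴿ M * (ξ - fromℤ (r i))) ⁻¹ in
        (ωˡᵉᵃᵈ k ξᵢ ≈± ω k ξᵢ) × (ω k ξᵢ ≈± ω k ξ)))))
mainTheorem1 lem ℝ k 1≤k r inj =
  -- The bound ρ is the largest of the |rᵢ|, so M is fixed before ξ is given.
  Reals.possible-scale lem ℝ k 1≤k r inj (proj₂ (maximum ℕₚ.≤-totalOrder (λ i → ℤ.∣ r i ∣)))
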